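{- For every function $f\colon\{0,1\}^n\to\{0,1\}$, every probability distribution $\mu$ on $\{0,1\}^n$ and every integer $k\ge 1$, $$k\cdot\mathsf{disc}(f,\mu)\;\ge\;\mathsf{disc}(f^{\oplus k},\mu^k)\;\ge\; k\cdot\big(\mathsf{disc}(f,\mu)-1\big).$$
   Context: For $g\colon\{0,1\}^N\to\{0,1\}$, a probability distribution $\nu$ on $\{0,1\}^N$ and an affine subspace $S\subseteq\{0,1\}^N=\mathbb{F}_2^N$, let $\mathsf{bias}(g,\nu,S)=\left|\sum_{x\in S}(-1)^{g(x)}\nu(x)\right|$, and let $\mathsf{disc}(g,\nu)=-\log_2\max_{S}\mathsf{bias}(g,\nu,S)$, the maximum over all affine subspaces $S$ of $\{0,1\}^N$. $f^{\oplus k}\colon(\{0,1\}^n)^k\to\{0,1\}$ is $f^{\oplus k}(x^1,\dots,x^k)=f(x^1)\oplus\cdots\oplus f(x^k)$, and $\mu^k=\mu\times\cdots\times\mu$ ($k$ times). -}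

module Defs where

open import Data.Bool.Base using (Bool; true; false; if_then_else_; _xor_; T)
open import Data.Bool.Properties using (T?)
open import Data.Integer.Base as ℤ using (ℤ; _⊖_)
open import Data.List.Base as List using (List; []; _∷_; _++_; map; foldr; filter; filterᵇ; cartesianProductWith)
open import Data.List.Membership.Propositional using (_∈_)
open import Data.List.Membership.Propositional.Properties
  using (∈-filter⁺; ∈-filter⁻; ∈-cartesianProductWith⁺)
open import Data.List.Relation.Unary.Any using (here; there)
open import Data.Nat.Base as ℕ using (ℕ; zero; suc)
import Data.Nat.Properties as ℕ
open import Data.Nat.Induction using (Acc; acc; <-wellFounded)
open import Data.Nat.Logarithm using (⌊log₂_⌋; ⌊log₂⌋-mono-≤; ⌊log₂⌊n/2⌋⌋≡⌊log₂n⌋∸1; ⌊log₂[2^n]⌋≡n)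
import Data.Nat.Solver
import Data.Integer.Properties as ℤ
import Data.Rational.Unnormalised.Base as ℚᵘ
import Data.Rational.Unnormalised.Properties as ℚᵘ
open import Data.Product.Base using (Σ; ∃; ∃-syntax; _×_; _,_; proj₁; proj₂)
open import Data.Rational.Base as ℚ
  using (ℚ; mkℚ; 0ℚ; 1ℚ; ½; _+_; _*_; _-_; -_; _⊔_; ∣_∣; _/_; 1/_; _≤_; _<_; ↥_; ↧ₙ_; Positive; NonNegative; NonZero; positive; nonNegative; *<*)
open import Data.Rational.Properties as ℚ using (≤-refl; ≤-trans; ≤-reflexive)
open import Data.Rational.Solver using (module +-*-Solver)
open import Data.Sum.Base using (inj₁; inj₂)
open import Data.Unit.Base using (tt)
open import Data.Vec.Base as Vec using (Vec; []; _∷_)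
open import Function.Base using (_∘_; case_of_)
open import Relation.Nullary.Decidable using (Dec; yes; no; map′; _×-dec_; _→-dec_; _⊎-dec_)
open import Relation.Binary.PropositionalEquality
  using (_≡_; _≗_; refl; sym; trans; cong; cong₂; subst; subst₂)

module S = Data.Nat.Solver.+-*-Solver
open +-*-Solver using (solve; _:=_; _:+_; _:*_; _:-_; :-_; con)

abstract

  0<1 : 0ℚ < 1ℚ
  0<1 = *<* (ℤ.+<+ (ℕ.s≤s ℕ.z≤n))

  scale : ∀ D ε → 0ℚ < D → 0ℚ < ε → ∃[ δ ] 0ℚ < δ × D * δ ≡ ε
  scale D ε 0<D 0<ε = 1/ D * ε , 0<δ , eq
    where
    instance
      D-pos : Positive D
      D-pos = positive 0<D
      ε-pos : Positive ε
      ε-pos = positive 0<ε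
      D-nonZero : NonZero D
      D-nonZero = ℚ.pos⇒nonZero D
    0<δ : 0ℚ < 1/ D * ε
    0<δ = ℚ.positive⁻¹ (1/ D * ε) {{ℚ.pos*pos⇒pos (1/ D) {{ℚ.1/pos⇒pos D}} ε}}
    eq : D * (1/ D * ε) ≡ ε
    eq = trans (sym (ℚ.*-assoc D (1/ D) ε))
               (trans (cong (_* ε) (ℚ.*-inverseʳ D)) (ℚ.*-identityˡ ε))

  halve : ∀ ε → 0ℚ < ε → ∃[ δ ] 0ℚ < δ × δ + δ ≡ ε
  halve ε 0<ε = let δ , 0<δ , eq = scale (1ℚ + 1ℚ) ε (ℚ.+-mono-< 0<1 0<1) 0<ε in
    δ , 0<δ , trans (solve 1 (λ d → d :+ d := (con 1ℚ :+ con 1ℚ) :* d) refl δ) eq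

  p≤∣p∣ : ∀ p → p ≤ ∣ p ∣
  p≤∣p∣ p with ℚ.≤-total 0ℚ p
  ... | inj₁ 0≤p = ≤-reflexive (sym (ℚ.0≤p⇒∣p∣≡p 0≤p))
  ... | inj₂ p≤0 = ≤-trans p≤0 (ℚ.0≤∣p∣ p)

  ∣p∣≤ : ∀ {p b} → p ≤ b → - p ≤ b → ∣ p ∣ ≤ b
  ∣p∣≤ {p} p≤b -p≤b with ℚ.∣p∣≡p∨∣p∣≡-p p
  ... | inj₁ eq = ≤-trans (≤-reflexive eq) p≤b
  ... | inj₂ eq = ≤-trans (≤-reflexive eq) -p≤b

  -p≤∣p∣ : ∀ p → - p ≤ ∣ p ∣
  -p≤∣p∣ p = ≤-trans (p≤∣p∣ (- p)) (≤-reflexive (ℚ.∣-p∣≡∣p∣ p))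

  ∣p-q∣-sym : ∀ p q → ∣ p - q ∣ ≡ ∣ q - p ∣
  ∣p-q∣-sym p q = trans (sym (ℚ.∣-p∣≡∣p∣ (p - q)))
    (cong ∣_∣ (solve 2 (λ a b → :- (a :- b) := b :- a) refl p q))

  p≤q+[p-q] : ∀ p q → p ≤ q + ∣ p - q ∣
  p≤q+[p-q] p q = ≤-trans (≤-reflexive (solve 2 (λ a b → a := b :+ (a :- b)) refl p q))
    (ℚ.+-monoʳ-≤ q (p≤∣p∣ (p - q)))

  p≤q+r⇒p-q≤r : ∀ {p q r} → p ≤ q + r → p - q ≤ r
  p≤q+r⇒p-q≤r {p} {q} {r} h = ≤-trans (ℚ.+-monoˡ-≤ (- q) h)
    (≤-reflexive (solve 2 (λ a b → a :+ b :- a := b) refl q r))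

  ∣p-q∣≤ : ∀ {p q r} → p ≤ q + r → q ≤ p + r → ∣ p - q ∣ ≤ r
  ∣p-q∣≤ {p} {q} h₁ h₂ = ∣p∣≤ (p≤q+r⇒p-q≤r h₁)
    (≤-trans (≤-reflexive (solve 2 (λ a b → :- (a :- b) := b :- a) refl p q)) (p≤q+r⇒p-q≤r h₂))

  ∣p-q∣≤r⇒p≤q+r : ∀ {p q r} → ∣ p - q ∣ ≤ r → p ≤ q + r
  ∣p-q∣≤r⇒p≤q+r {p} {q} h = ≤-trans (p≤q+[p-q] p q) (ℚ.+-monoʳ-≤ q h)

  +-lipschitz : ∀ p q p′ q′ → ∣ (p + q) - (p′ + q′) ∣ ≤ ∣ p - p′ ∣ + ∣ q - q′ ∣
  +-lipschitz p q p′ q′ = ≤-trans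
    (≤-reflexive (cong ∣_∣ (solve 4 (λ a b c d → (a :+ b) :- (c :+ d) := (a :- c) :+ (b :- d)) refl p q p′ q′)))
    (ℚ.∣p+q∣≤∣p∣+∣q∣ (p - p′) (q - q′))

  neg-lipschitz : ∀ p p′ → ∣ - p - - p′ ∣ ≤ ∣ p - p′ ∣
  neg-lipschitz p p′ = ≤-reflexive (trans
    (cong ∣_∣ (solve 2 (λ a c → :- a :- :- c := :- (a :- c)) refl p p′)) (ℚ.∣-p∣≡∣p∣ (p - p′)))

  ∣∣-lipschitz : ∀ p p′ → ∣ ∣ p ∣ - ∣ p′ ∣ ∣ ≤ ∣ p - p′ ∣
  ∣∣-lipschitz p p′ = ∣p-q∣≤ (bound p p′)
    (≤-trans (bound p′ p) (≤-reflexive (cong (∣ p ∣ +_) (∣p-q∣-sym p′ p))))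
    where
    bound : ∀ a b → ∣ a ∣ ≤ ∣ b ∣ + ∣ a - b ∣
    bound a b = ≤-trans
      (≤-reflexive (cong ∣_∣ (solve 2 (λ x y → x := y :+ (x :- y)) refl a b)))
      (ℚ.∣p+q∣≤∣p∣+∣q∣ b (a - b))

  ⊔-lipschitz : ∀ p q p′ q′ → ∣ (p ⊔ q) - (p′ ⊔ q′) ∣ ≤ ∣ p - p′ ∣ + ∣ q - q′ ∣
  ⊔-lipschitz p q p′ q′ = ∣p-q∣≤ (bound p q p′ q′)
    (≤-trans (bound p′ q′ p q)
      (≤-reflexive (cong ((p ⊔ q) +_) (cong₂ _+_ (∣p-q∣-sym p′ p) (∣p-q∣-sym q′ q)))))
    where
    bound : ∀ a b c d → a ⊔ b ≤ (c ⊔ d) + (∣ a - c ∣ + ∣ b - d ∣)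
    bound a b c d = ℚ.⊔-lub
      (≤-trans (p≤q+[p-q] a c) (ℚ.+-mono-≤ (ℚ.p≤p⊔q c d) le₁))
      (≤-trans (p≤q+[p-q] b d) (ℚ.+-mono-≤ (ℚ.p≤q⊔p c d) le₂))
      where
      le₁ : ∣ a - c ∣ ≤ ∣ a - c ∣ + ∣ b - d ∣
      le₁ = ≤-trans (≤-reflexive (sym (ℚ.+-identityʳ _))) (ℚ.+-monoʳ-≤ ∣ a - c ∣ (ℚ.0≤∣p∣ (b - d)))
      le₂ : ∣ b - d ∣ ≤ ∣ a - c ∣ + ∣ b - d ∣
      le₂ = ≤-trans (≤-reflexive (sym (ℚ.+-identityˡ _))) (ℚ.+-monoˡ-≤ ∣ b - d ∣ (ℚ.0≤∣p∣ (a - c)))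

  *-mono-≤ : ∀ {p q r s} → 0ℚ ≤ r → 0ℚ ≤ q → p ≤ q → r ≤ s → p * r ≤ q * s
  *-mono-≤ {p} {q} {r} {s} 0≤r 0≤q p≤q r≤s = ≤-trans
    (ℚ.*-monoʳ-≤-nonNeg r {{nonNegative 0≤r}} p≤q)
    (ℚ.*-monoˡ-≤-nonNeg q {{nonNegative 0≤q}} r≤s)

  *-close : ∀ {D δ} p q p′ q′ → 0ℚ ≤ D → ∣ p ∣ ≤ D → ∣ q′ ∣ ≤ D → ∣ p - p′ ∣ ≤ δ → ∣ q - q′ ∣ ≤ δ →
            ∣ p * q - p′ * q′ ∣ ≤ (D + D) * δ
  *-close {D} {δ} p q p′ q′ 0≤D p≤D q≤D dp dq = ≤-trans
    (≤-reflexive (cong ∣_∣ (solve 4 (λ a b c d → a :* b :- c :* d := a :* (b :- d) :+ d :* (a :- c)) refl p q p′ q′)))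
    (≤-trans (ℚ.∣p+q∣≤∣p∣+∣q∣ (p * (q - q′)) (q′ * (p - p′)))
    (≤-trans (ℚ.+-mono-≤ (part p (q - q′) p≤D dq) (part q′ (p - p′) q≤D dp))
      (≤-reflexive (sym (ℚ.*-distribʳ-+ δ D D)))))
    where
    part : ∀ a b → ∣ a ∣ ≤ D → ∣ b ∣ ≤ δ → ∣ a * b ∣ ≤ D * δ
    part a b ha hb = ≤-trans (≤-reflexive (ℚ.∣p*q∣≡∣p∣*∣q∣ a b)) (*-mono-≤ (ℚ.0≤∣p∣ b) 0≤D ha hb)

Eventually : (ℕ → Set) → Set
Eventually P = ∃[ N ] ∀ n → N ℕ.≤ n → P n

Cauchy : (ℕ → ℚ) → Set
Cauchy x = ∀ ε → 0ℚ < ε → ∃[ N ] ∀ m n → N ℕ.≤ m → N ℕ.≤ n → ∣ x m - x n ∣ ≤ ε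

-- Reals are Cauchy sequences of rationals, and two of them are equal when
-- related by _≃ᴿ_ below.
record ℝ : Set where
  constructor mkℝ
  field
    seq    : ℕ → ℚ
    cauchy : Cauchy seq

open ℝ public

infix 4 _≤ᴿ_ _<ᴿ_ _≃ᴿ_

-- The slack ε makes _≤ᴿ_ a relation between limits rather than terms.
_≤ᴿ_ : ℝ → ℝ → Set
x ≤ᴿ y = ∀ ε → 0ℚ < ε → Eventually λ n → seq x n ≤ seq y n + ε

_<ᴿ_ : ℝ → ℝ → Set
x <ᴿ y = ∃[ δ ] 0ℚ < δ × Eventually λ n → seq x n + δ ≤ seq y n

_≃ᴿ_ : ℝ → ℝ → Set
x ≃ᴿ y = x ≤ᴿ y × y ≤ᴿ x

abstract

  eventually-× : ∀ {P Q R : ℕ → Set} → (∀ {n} → P n → Q n → R n) → Eventually P → Eventually Q → Eventually R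
  eventually-× f (M , p) (N , q) = M ℕ.⊔ N , λ n h →
    f (p n (ℕ.m⊔n≤o⇒m≤o M N h)) (q n (ℕ.m⊔n≤o⇒n≤o M N h))

  cauchy₁ : ∀ x z → Cauchy x → (∀ m n → ∣ z m - z n ∣ ≤ ∣ x m - x n ∣) → Cauchy z
  cauchy₁ x z cx lip ε 0<ε = let N , h = cx ε 0<ε in
    N , λ m n m≥N n≥N → ≤-trans (lip m n) (h m n m≥N n≥N)

  cauchy₂ : ∀ x y z → Cauchy x → Cauchy y →
            (∀ m n → ∣ z m - z n ∣ ≤ ∣ x m - x n ∣ + ∣ y m - y n ∣) → Cauchy z
  cauchy₂ x y z cx cy lip ε 0<ε =
    let δ , 0<δ , 2δ≡ε = halve ε 0<ε
        M , p = cx δ 0<δ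
        N , q = cy δ 0<δ
    in M ℕ.⊔ N , λ m n hm hn → ≤-trans (lip m n) (≤-trans
         (ℚ.+-mono-≤ (p m n (ℕ.m⊔n≤o⇒m≤o M N hm) (ℕ.m⊔n≤o⇒m≤o M N hn))
                     (q m n (ℕ.m⊔n≤o⇒n≤o M N hm) (ℕ.m⊔n≤o⇒n≤o M N hn)))
         (≤-reflexive 2δ≡ε))

  cauchy-const : ∀ q → Cauchy (λ _ → q)
  cauchy-const q ε 0<ε = 0 , λ _ _ _ _ →
    ≤-trans (≤-reflexive (cong ∣_∣ (ℚ.+-inverseʳ q))) (ℚ.<⇒≤ 0<ε)

  bounded : ∀ x → Cauchy x → ∃[ B ] 0ℚ < B × Eventually λ n → ∣ x n ∣ ≤ B
  bounded x cx = let N , h = cx 1ℚ 0<1 in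
    ∣ x N ∣ + 1ℚ ,
    ℚ.<-≤-trans 0<1 (≤-trans (≤-reflexive (sym (ℚ.+-identityˡ 1ℚ))) (ℚ.+-monoˡ-≤ 1ℚ (ℚ.0≤∣p∣ (x N)))) ,
    N , λ n n≥N → ≤-trans
      (≤-reflexive (cong ∣_∣ (solve 2 (λ a b → a := b :+ (a :- b)) refl (x n) (x N))))
      (≤-trans (ℚ.∣p+q∣≤∣p∣+∣q∣ (x N) (x n - x N)) (ℚ.+-monoʳ-≤ ∣ x N ∣ (h n N n≥N ℕ.≤-refl)))

  bounded₂ : ∀ x y → Cauchy x → Cauchy y → ∃[ B ] 0ℚ < B × Eventually λ n → (∣ x n ∣ ≤ B × ∣ y n ∣ ≤ B)
  bounded₂ x y cx cy =
    let B , 0<B , eB = bounded x cx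
        C , 0<C , eC = bounded y cy
    in B ⊔ C , ℚ.<-≤-trans 0<B (ℚ.p≤p⊔q B C) ,
       eventually-× (λ p q → ≤-trans p (ℚ.p≤p⊔q B C) , ≤-trans q (ℚ.p≤q⊔p B C)) eB eC

  *-scale : ∀ B ε → 0ℚ < B → 0ℚ < ε → ∃[ δ ] 0ℚ < δ × (B + B) * δ ≡ ε
  *-scale B ε 0<B = scale (B + B) ε
    (ℚ.+-mono-< 0<B 0<B)

  cauchy-* : ∀ x y → Cauchy x → Cauchy y → Cauchy (λ n → x n * y n)
  cauchy-* x y cx cy ε 0<ε =
    let B , 0<B , K , b = bounded₂ x y cx cy
        δ , 0<δ , eq    = *-scale B ε 0<B 0<ε
        M , p = cx δ 0<δ
        N , q = cy δ 0<δ
        L = K ℕ.⊔ (M ℕ.⊔ N)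
        toK : ∀ {n} → L ℕ.≤ n → K ℕ.≤ n
        toK = ℕ.m⊔n≤o⇒m≤o K (M ℕ.⊔ N)
        toM : ∀ {n} → L ℕ.≤ n → M ℕ.≤ n
        toM = ℕ.m⊔n≤o⇒m≤o M N ∘ ℕ.m⊔n≤o⇒n≤o K (M ℕ.⊔ N)
        toN : ∀ {n} → L ℕ.≤ n → N ℕ.≤ n
        toN = ℕ.m⊔n≤o⇒n≤o M N ∘ ℕ.m⊔n≤o⇒n≤o K (M ℕ.⊔ N)
    in L , λ m n hm hn → ≤-trans
         (*-close (x m) (y m) (x n) (y n) (ℚ.<⇒≤ 0<B)
           (proj₁ (b m (toK hm))) (proj₂ (b n (toK hn)))
           (p m n (toM hm) (toM hn)) (q m n (toN hm) (toN hn)))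
         (≤-reflexive eq)

infixl 6 _+ᴿ_ _-ᴿ_ _⊔ᴿ_
infixl 7 _*ᴿ_
infix  8 -ᴿ_

fromℚ : ℚ → ℝ
fromℚ q = mkℝ (λ _ → q) (cauchy-const q)

fromℕ : ℕ → ℝ
fromℕ n = fromℚ (ℤ.+ n / 1)

0ᴿ 1ᴿ : ℝ
0ᴿ = fromℚ 0ℚ
1ᴿ = fromℚ 1ℚ

_+ᴿ_ _*ᴿ_ _⊔ᴿ_ : ℝ → ℝ → ℝ
mkℝ x cx +ᴿ mkℝ y cy = mkℝ z (cauchy₂ x y z cx cy λ m n → +-lipschitz (x m) (y m) (x n) (y n))
  where z = λ n → x n + y n
mkℝ x cx *ᴿ mkℝ y cy = mkℝ (λ n → x n * y n) (cauchy-* x y cx cy)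
mkℝ x cx ⊔ᴿ mkℝ y cy = mkℝ z (cauchy₂ x y z cx cy λ m n → ⊔-lipschitz (x m) (y m) (x n) (y n))
  where z = λ n → x n ⊔ y n

-ᴿ_ ∣_∣ᴿ : ℝ → ℝ
-ᴿ mkℝ x cx   = mkℝ z (cauchy₁ x z cx λ m n → neg-lipschitz (x m) (x n))
  where z = λ n → - x n
∣ mkℝ x cx ∣ᴿ = mkℝ z (cauchy₁ x z cx λ m n → ∣∣-lipschitz (x m) (x n))
  where z = λ n → ∣ x n ∣

_-ᴿ_ : ℝ → ℝ → ℝ
x -ᴿ y = x +ᴿ (-ᴿ y)

abstract

  ≤ᴿ-pointwise : ∀ {x y} → (∀ n → seq x n ≤ seq y n) → x ≤ᴿ y
  ≤ᴿ-pointwise {x} {y} h ε 0<ε = 0 , λ n _ → ≤-trans (h n)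
    (≤-trans (≤-reflexive (sym (ℚ.+-identityʳ _))) (ℚ.+-monoʳ-≤ (seq y n) (ℚ.<⇒≤ 0<ε)))

  ≃ᴿ-pointwise : ∀ {x y} → (∀ n → seq x n ≡ seq y n) → x ≃ᴿ y
  ≃ᴿ-pointwise {x} {y} h = ≤ᴿ-pointwise {x} {y} (λ n → ≤-reflexive (h n)) ,
                           ≤ᴿ-pointwise {y} {x} (λ n → ≤-reflexive (sym (h n)))

  ≤ᴿ-trans : ∀ {x y z} → x ≤ᴿ y → y ≤ᴿ z → x ≤ᴿ z
  ≤ᴿ-trans {x} {y} {z} h₁ h₂ ε 0<ε =
    let δ , 0<δ , eq = halve ε 0<ε in
    eventually-× (λ {n} p q → ≤-trans p (≤-trans (ℚ.+-monoˡ-≤ δ q) (≤-reflexive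
      (trans (ℚ.+-assoc (seq z n) δ δ) (cong (seq z n +_) eq))))) (h₁ δ 0<δ) (h₂ δ 0<δ)

  ≃ᴿ-sym : ∀ {x y} → x ≃ᴿ y → y ≃ᴿ x
  ≃ᴿ-sym (p , q) = q , p

  ≃ᴿ-trans : ∀ {x y z} → x ≃ᴿ y → y ≃ᴿ z → x ≃ᴿ z
  ≃ᴿ-trans {x} {y} {z} (p , q) (r , s) = ≤ᴿ-trans {x} {y} {z} p r , ≤ᴿ-trans {z} {y} {x} s q

  ≃ᴿ⇒close : ∀ {x y} → x ≃ᴿ y → ∀ ε → 0ℚ < ε → Eventually λ n → ∣ seq x n - seq y n ∣ ≤ ε
  ≃ᴿ⇒close (p , q) ε 0<ε = eventually-× ∣p-q∣≤ (p ε 0<ε) (q ε 0<ε)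

  close⇒≃ᴿ : ∀ {x y} → (∀ ε → 0ℚ < ε → Eventually λ n → ∣ seq x n - seq y n ∣ ≤ ε) → x ≃ᴿ y
  close⇒≃ᴿ {x} {y} h =
    (λ ε 0<ε → let N , p = h ε 0<ε in N , λ n n≥N → ∣p-q∣≤r⇒p≤q+r (p n n≥N)) ,
    (λ ε 0<ε → let N , p = h ε 0<ε in N , λ n n≥N → ∣p-q∣≤r⇒p≤q+r
      (≤-trans (≤-reflexive (∣p-q∣-sym (seq y n) (seq x n))) (p n n≥N)))

  *ᴿ-cong : ∀ {x x′ y y′} → x ≃ᴿ x′ → y ≃ᴿ y′ → x *ᴿ y ≃ᴿ x′ *ᴿ y′
  *ᴿ-cong {x} {x′} {y} {y′} ex ey = close⇒≃ᴿ {x *ᴿ y} {x′ *ᴿ y′} λ ε 0<ε →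
    let B , 0<B , eB = bounded₂ (seq x) (seq y′) (cauchy x) (cauchy y′)
        δ , 0<δ , eq = *-scale B ε 0<B 0<ε
    in eventually-× (λ {n} (bx , by) (dx , dy) → ≤-trans
         (*-close (seq x n) (seq y n) (seq x′ n) (seq y′ n) (ℚ.<⇒≤ 0<B) bx by dx dy) (≤-reflexive eq))
         eB (eventually-× _,_ (≃ᴿ⇒close {x} {x′} ex δ 0<δ) (≃ᴿ⇒close {y} {y′} ey δ 0<δ))

  0≤⇒≃∣∣ : ∀ {x} → 0ᴿ ≤ᴿ x → x ≃ᴿ ∣ x ∣ᴿ
  0≤⇒≃∣∣ {x} 0≤x = ≤ᴿ-pointwise {x} {∣ x ∣ᴿ} (λ n → p≤∣p∣ (seq x n)) , λ ε 0<ε →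
    let δ , 0<δ , eq = halve ε 0<ε
        N , h = 0≤x δ 0<δ
    in N , λ n n≥N → ∣p∣≤
         (≤-trans (≤-reflexive (sym (ℚ.+-identityʳ _))) (ℚ.+-monoʳ-≤ (seq x n) (ℚ.<⇒≤ 0<ε)))
         (≤-trans (≤-reflexive (solve 1 (λ a → :- a := con 0ℚ :+ con 0ℚ :- a) refl (seq x n)))
         (≤-trans (ℚ.+-monoˡ-≤ (- seq x n) (ℚ.+-mono-≤ (h n n≥N) (h n n≥N)))
         (≤-trans (≤-reflexive (solve 2 (λ a d → (a :+ d) :+ (a :+ d) :- a := a :+ (d :+ d)) refl (seq x n) δ))
         (≤-reflexive (cong (seq x n +_) eq)))))

  *ᴿ-nonneg : ∀ {x y} → 0ᴿ ≤ᴿ x → 0ᴿ ≤ᴿ y → 0ᴿ ≤ᴿ x *ᴿ y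
  *ᴿ-nonneg {x} {y} 0≤x 0≤y = ≤ᴿ-trans {0ᴿ} {∣ x ∣ᴿ *ᴿ ∣ y ∣ᴿ} {x *ᴿ y}
    (≤ᴿ-pointwise {0ᴿ} {∣ x ∣ᴿ *ᴿ ∣ y ∣ᴿ} λ n →
      ≤-trans (ℚ.0≤∣p∣ (seq x n * seq y n)) (≤-reflexive (ℚ.∣p*q∣≡∣p∣*∣q∣ (seq x n) (seq y n))))
    (proj₂ (*ᴿ-cong {x} {∣ x ∣ᴿ} {y} {∣ y ∣ᴿ} (0≤⇒≃∣∣ {x} 0≤x) (0≤⇒≃∣∣ {y} 0≤y)))

ι : ℕ → ℚ
ι n = ℤ.+ n / 1

-- For q = a / b > 0 this is (⌊log₂ aᵐ⌋ - ⌊log₂ bᵐ⌋) / m with m = suc i,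
-- which is within 1 / m of log₂ q. The value for q ≤ 0 is irrelevant.
log₂-approx : ℕ → ℚ → ℚ
log₂-approx i q = (⌊log₂ ℤ.∣ ↥ q ∣ ℕ.^ suc i ⌋ ⊖ ⌊log₂ ↧ₙ q ℕ.^ suc i ⌋) / suc i

2^⌊log₂n⌋≤n : ∀ n → .{{ℕ.NonZero n}} → 2 ℕ.^ ⌊log₂ n ⌋ ℕ.≤ n
2^⌊log₂n⌋≤n n = go n (<-wellFounded n)
  where
  go : ∀ n → Acc ℕ._<_ n → .{{ℕ.NonZero n}} → 2 ℕ.^ ⌊log₂ n ⌋ ℕ.≤ n
  go 1 _ = ℕ.≤-refl
  go n@(suc (suc m)) (acc rs) = begin
    2 ℕ.^ ⌊log₂ n ⌋                        ≡⟨ cong (2 ℕ.^_) (sym (ℕ.m+[n∸m]≡n {1} 1≤log)) ⟩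
    2 ℕ.* 2 ℕ.^ (⌊log₂ n ⌋ ℕ.∸ 1)          ≡⟨ cong (λ e → 2 ℕ.* 2 ℕ.^ e) (sym (⌊log₂⌊n/2⌋⌋≡⌊log₂n⌋∸1 n)) ⟩
    2 ℕ.* 2 ℕ.^ ⌊log₂ ℕ.⌊ n /2⌋ ⌋          ≤⟨ ℕ.*-monoʳ-≤ 2 (go ℕ.⌊ n /2⌋ (rs (ℕ.⌊n/2⌋<n (suc m)))) ⟩
    2 ℕ.* ℕ.⌊ n /2⌋                        ≡⟨ cong (ℕ.⌊ n /2⌋ ℕ.+_) (ℕ.+-identityʳ _) ⟩
    ℕ.⌊ n /2⌋ ℕ.+ ℕ.⌊ n /2⌋                ≤⟨ ℕ.+-monoʳ-≤ ℕ.⌊ n /2⌋ (ℕ.⌊n/2⌋≤⌈n/2⌉ n) ⟩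
    ℕ.⌊ n /2⌋ ℕ.+ ℕ.⌈ n /2⌉                ≡⟨ ℕ.⌊n/2⌋+⌈n/2⌉≡n n ⟩
    n                                      ∎
    where
    open ℕ.≤-Reasoning
    1≤log : 1 ℕ.≤ ⌊log₂ n ⌋
    1≤log = ⌊log₂⌋-mono-≤ {2} {n} (ℕ.s≤s (ℕ.s≤s ℕ.z≤n))

n<2^[1+⌊log₂n⌋] : ∀ n → n ℕ.< 2 ℕ.^ suc ⌊log₂ n ⌋
n<2^[1+⌊log₂n⌋] n = ℕ.≰⇒> λ h → ℕ.<-irrefl refl
  (ℕ.≤-trans (ℕ.≤-reflexive (sym (⌊log₂[2^n]⌋≡n (suc ⌊log₂ n ⌋)))) (⌊log₂⌋-mono-≤ h))

2^-cancel-≤ : ∀ a b → 2 ℕ.^ a ℕ.≤ 2 ℕ.^ b → a ℕ.≤ b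
2^-cancel-≤ a b h = subst₂ ℕ._≤_ (⌊log₂[2^n]⌋≡n a) (⌊log₂[2^n]⌋≡n b) (⌊log₂⌋-mono-≤ h)

-- (1 - 1/w)^j ≥ 1 - j/w with w = suc u
bernoulli : ∀ u j → suc u ℕ.* suc u ℕ.^ j ℕ.≤ u ℕ.^ j ℕ.* suc u ℕ.+ j ℕ.* suc u ℕ.^ j
bernoulli u zero    = ℕ.≤-reflexive (S.solve 1 (λ u → (S.con 1 S.:+ u) S.:* S.con 1 S.:= S.con 1 S.:* (S.con 1 S.:+ u) S.:+ S.con 0) refl u)
bernoulli u (suc j) = begin
  w ℕ.* (w ℕ.* p)                                  ≡⟨ S.solve 2 (λ u p → (S.con 1 S.:+ u) S.:* ((S.con 1 S.:+ u) S.:* p)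
                                                         S.:= u S.:* ((S.con 1 S.:+ u) S.:* p) S.:+ (S.con 1 S.:+ u) S.:* p) refl u p ⟩
  u ℕ.* (w ℕ.* p) ℕ.+ w ℕ.* p                      ≤⟨ ℕ.+-monoˡ-≤ (w ℕ.* p) (ℕ.*-monoʳ-≤ u (bernoulli u j)) ⟩
  u ℕ.* (q ℕ.* w ℕ.+ j ℕ.* p) ℕ.+ w ℕ.* p          ≤⟨ ℕ.m≤m+n _ (j ℕ.* p) ⟩
  u ℕ.* (q ℕ.* w ℕ.+ j ℕ.* p) ℕ.+ w ℕ.* p ℕ.+ j ℕ.* p
                                                   ≡⟨ S.solve 4 (λ u j p q →
                                                         u S.:* (q S.:* (S.con 1 S.:+ u) S.:+ j S.:* p) S.:+ (S.con 1 S.:+ u) S.:* p S.:+ j S.:* p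
                                                         S.:= (u S.:* q) S.:* (S.con 1 S.:+ u) S.:+ (S.con 1 S.:+ j) S.:* ((S.con 1 S.:+ u) S.:* p)) refl u j p q ⟩
  (u ℕ.* q) ℕ.* w ℕ.+ suc j ℕ.* (w ℕ.* p)          ∎
  where
  open ℕ.≤-Reasoning
  w = suc u
  p = w ℕ.^ j
  q = u ℕ.^ j

-- (1 - 1/(2K))^K ≥ 1/2
half-power : ∀ k u → let K = suc k in suc u ≡ K ℕ.+ K → suc u ℕ.^ K ℕ.≤ 2 ℕ.* u ℕ.^ K
half-power k u eq = ℕ.*-cancelˡ-≤ K (ℕ.+-cancelʳ-≤ (K ℕ.* p) (K ℕ.* p) (K ℕ.* (2 ℕ.* q)) (begin
  K ℕ.* p ℕ.+ K ℕ.* p              ≡⟨ sym (ℕ.*-distribʳ-+ p K K) ⟩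
  (K ℕ.+ K) ℕ.* p                  ≡⟨ cong (ℕ._* p) (sym eq) ⟩
  suc u ℕ.* p                      ≤⟨ bernoulli u K ⟩
  q ℕ.* suc u ℕ.+ K ℕ.* p          ≡⟨ cong (λ w → q ℕ.* w ℕ.+ K ℕ.* p) eq ⟩
  q ℕ.* (K ℕ.+ K) ℕ.+ K ℕ.* p      ≡⟨ cong (ℕ._+ K ℕ.* p) (S.solve 2 (λ q K → q S.:* (K S.:+ K) S.:= K S.:* (S.con 2 S.:* q)) refl q K) ⟩
  K ℕ.* (2 ℕ.* q) ℕ.+ K ℕ.* p      ∎))
  where
  open ℕ.≤-Reasoning
  K = suc k
  p = suc u ℕ.^ K
  q = u ℕ.^ K

^-distrib-* : ∀ a b n → (a ℕ.* b) ℕ.^ n ≡ a ℕ.^ n ℕ.* b ℕ.^ n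
^-distrib-* a b zero    = refl
^-distrib-* a b (suc n) = trans (cong (a ℕ.* b ℕ.*_) (^-distrib-* a b n))
  (S.solve 4 (λ a b x y → a S.:* b S.:* (x S.:* y) S.:= a S.:* x S.:* (b S.:* y)) refl a b (a ℕ.^ n) (b ℕ.^ n))

ratio-power : ∀ k u s t → let K = suc k in suc u ≡ K ℕ.+ K → u ℕ.* s ℕ.≤ suc u ℕ.* t →
              s ℕ.^ K ℕ.≤ 2 ℕ.* t ℕ.^ K
ratio-power k u s t eq h = ℕ.*-cancelˡ-≤ (suc u ℕ.^ K) {{ℕ.m^n≢0 (suc u) K}} (begin
  suc u ℕ.^ K ℕ.* s ℕ.^ K              ≤⟨ ℕ.*-monoˡ-≤ (s ℕ.^ K) (half-power k u eq) ⟩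
  2 ℕ.* u ℕ.^ K ℕ.* s ℕ.^ K            ≡⟨ trans (ℕ.*-assoc 2 (u ℕ.^ K) (s ℕ.^ K)) (cong (2 ℕ.*_) (sym (^-distrib-* u s K))) ⟩
  2 ℕ.* (u ℕ.* s) ℕ.^ K                ≤⟨ ℕ.*-monoʳ-≤ 2 (ℕ.^-monoˡ-≤ K h) ⟩
  2 ℕ.* (suc u ℕ.* t) ℕ.^ K            ≡⟨ cong (2 ℕ.*_) (^-distrib-* (suc u) t K) ⟩
  2 ℕ.* (suc u ℕ.^ K ℕ.* t ℕ.^ K)      ≡⟨ S.solve 2 (λ x y → S.con 2 S.:* (x S.:* y) S.:= x S.:* (S.con 2 S.:* y)) refl (suc u ℕ.^ K) (t ℕ.^ K) ⟩
  suc u ℕ.^ K ℕ.* (2 ℕ.* t ℕ.^ K)      ∎)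
  where
  open ℕ.≤-Reasoning
  K = suc k

-- If (p d′)^K ≤ 2 (p′ d)^K then log₂ (p/d) ≤ log₂ (p′/d′) + 1/K, approximately.
log-compare : ∀ K M N p d p′ d′ → .{{ℕ.NonZero p}} → .{{ℕ.NonZero d}} → .{{ℕ.NonZero p′}} → .{{ℕ.NonZero d′}} →
  (p ℕ.* d′) ℕ.^ K ℕ.≤ 2 ℕ.* (p′ ℕ.* d) ℕ.^ K →
  ⌊log₂ p ℕ.^ M ⌋ ℕ.* (N ℕ.* K) ℕ.+ ⌊log₂ d′ ℕ.^ N ⌋ ℕ.* (M ℕ.* K) ℕ.≤
  M ℕ.* N ℕ.+ (suc ⌊log₂ p′ ℕ.^ N ⌋ ℕ.* (M ℕ.* K) ℕ.+ suc ⌊log₂ d ℕ.^ M ⌋ ℕ.* (N ℕ.* K))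
log-compare K M N p d p′ d′ h = 2^-cancel-≤ _ _ (begin
  2 ℕ.^ (a ℕ.* (N ℕ.* K) ℕ.+ b′ ℕ.* (M ℕ.* K))
    ≡⟨ ℕ.^-distribˡ-+-* 2 (a ℕ.* (N ℕ.* K)) (b′ ℕ.* (M ℕ.* K)) ⟩
  2 ℕ.^ (a ℕ.* (N ℕ.* K)) ℕ.* 2 ℕ.^ (b′ ℕ.* (M ℕ.* K))
    ≡⟨ cong₂ ℕ._*_ (sym (ℕ.^-*-assoc 2 a (N ℕ.* K))) (sym (ℕ.^-*-assoc 2 b′ (M ℕ.* K))) ⟩
  (2 ℕ.^ a) ℕ.^ (N ℕ.* K) ℕ.* (2 ℕ.^ b′) ℕ.^ (M ℕ.* K)
    ≤⟨ ℕ.*-mono-≤ (ℕ.^-monoˡ-≤ (N ℕ.* K) (2^⌊log₂n⌋≤n (p ℕ.^ M) {{ℕ.m^n≢0 p M}}))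
                  (ℕ.^-monoˡ-≤ (M ℕ.* K) (2^⌊log₂n⌋≤n (d′ ℕ.^ N) {{ℕ.m^n≢0 d′ N}})) ⟩
  (p ℕ.^ M) ℕ.^ (N ℕ.* K) ℕ.* (d′ ℕ.^ N) ℕ.^ (M ℕ.* K)
    ≡⟨ cong₂ ℕ._*_ (regroup p M N) (regroup′ d′ N M) ⟩
  (p ℕ.^ K) ℕ.^ (M ℕ.* N) ℕ.* (d′ ℕ.^ K) ℕ.^ (M ℕ.* N)
    ≡⟨ sym (^-distrib-* (p ℕ.^ K) (d′ ℕ.^ K) (M ℕ.* N)) ⟩
  (p ℕ.^ K ℕ.* d′ ℕ.^ K) ℕ.^ (M ℕ.* N)
    ≡⟨ cong (ℕ._^ (M ℕ.* N)) (sym (^-distrib-* p d′ K)) ⟩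
  ((p ℕ.* d′) ℕ.^ K) ℕ.^ (M ℕ.* N)
    ≤⟨ ℕ.^-monoˡ-≤ (M ℕ.* N) h ⟩
  (2 ℕ.* (p′ ℕ.* d) ℕ.^ K) ℕ.^ (M ℕ.* N)
    ≡⟨ ^-distrib-* 2 ((p′ ℕ.* d) ℕ.^ K) (M ℕ.* N) ⟩
  2 ℕ.^ (M ℕ.* N) ℕ.* ((p′ ℕ.* d) ℕ.^ K) ℕ.^ (M ℕ.* N)
    ≡⟨ cong (λ z → 2 ℕ.^ (M ℕ.* N) ℕ.* z ℕ.^ (M ℕ.* N)) (^-distrib-* p′ d K) ⟩
  2 ℕ.^ (M ℕ.* N) ℕ.* (p′ ℕ.^ K ℕ.* d ℕ.^ K) ℕ.^ (M ℕ.* N)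
    ≡⟨ cong (2 ℕ.^ (M ℕ.* N) ℕ.*_) (^-distrib-* (p′ ℕ.^ K) (d ℕ.^ K) (M ℕ.* N)) ⟩
  2 ℕ.^ (M ℕ.* N) ℕ.* ((p′ ℕ.^ K) ℕ.^ (M ℕ.* N) ℕ.* (d ℕ.^ K) ℕ.^ (M ℕ.* N))
    ≡⟨ cong (2 ℕ.^ (M ℕ.* N) ℕ.*_) (sym (cong₂ ℕ._*_ (regroup′ p′ N M) (regroup d M N))) ⟩
  2 ℕ.^ (M ℕ.* N) ℕ.* ((p′ ℕ.^ N) ℕ.^ (M ℕ.* K) ℕ.* (d ℕ.^ M) ℕ.^ (N ℕ.* K))
    ≤⟨ ℕ.*-monoʳ-≤ (2 ℕ.^ (M ℕ.* N)) (ℕ.*-mono-≤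
         (ℕ.^-monoˡ-≤ (M ℕ.* K) (ℕ.<⇒≤ (n<2^[1+⌊log₂n⌋] (p′ ℕ.^ N))))
         (ℕ.^-monoˡ-≤ (N ℕ.* K) (ℕ.<⇒≤ (n<2^[1+⌊log₂n⌋] (d ℕ.^ M))))) ⟩
  2 ℕ.^ (M ℕ.* N) ℕ.* ((2 ℕ.^ suc a′) ℕ.^ (M ℕ.* K) ℕ.* (2 ℕ.^ suc b) ℕ.^ (N ℕ.* K))
    ≡⟨ cong (2 ℕ.^ (M ℕ.* N) ℕ.*_) (cong₂ ℕ._*_ (ℕ.^-*-assoc 2 (suc a′) (M ℕ.* K)) (ℕ.^-*-assoc 2 (suc b) (N ℕ.* K))) ⟩
  2 ℕ.^ (M ℕ.* N) ℕ.* (2 ℕ.^ (suc a′ ℕ.* (M ℕ.* K)) ℕ.* 2 ℕ.^ (suc b ℕ.* (N ℕ.* K)))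
    ≡⟨ cong (2 ℕ.^ (M ℕ.* N) ℕ.*_) (sym (ℕ.^-distribˡ-+-* 2 (suc a′ ℕ.* (M ℕ.* K)) (suc b ℕ.* (N ℕ.* K)))) ⟩
  2 ℕ.^ (M ℕ.* N) ℕ.* 2 ℕ.^ (suc a′ ℕ.* (M ℕ.* K) ℕ.+ suc b ℕ.* (N ℕ.* K))
    ≡⟨ sym (ℕ.^-distribˡ-+-* 2 (M ℕ.* N) (suc a′ ℕ.* (M ℕ.* K) ℕ.+ suc b ℕ.* (N ℕ.* K))) ⟩
  2 ℕ.^ (M ℕ.* N ℕ.+ (suc a′ ℕ.* (M ℕ.* K) ℕ.+ suc b ℕ.* (N ℕ.* K)))
    ∎)
  where
  open ℕ.≤-Reasoning
  a = ⌊log₂ p ℕ.^ M ⌋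
  b = ⌊log₂ d ℕ.^ M ⌋
  a′ = ⌊log₂ p′ ℕ.^ N ⌋
  b′ = ⌊log₂ d′ ℕ.^ N ⌋
  regroup : ∀ x A B → (x ℕ.^ A) ℕ.^ (B ℕ.* K) ≡ (x ℕ.^ K) ℕ.^ (A ℕ.* B)
  regroup x A B = trans (ℕ.^-*-assoc x A (B ℕ.* K)) (trans
    (cong (x ℕ.^_) (S.solve 3 (λ A B K → A S.:* (B S.:* K) S.:= K S.:* (A S.:* B)) refl A B K))
    (sym (ℕ.^-*-assoc x K (A ℕ.* B))))
  regroup′ : ∀ x A B → (x ℕ.^ A) ℕ.^ (B ℕ.* K) ≡ (x ℕ.^ K) ℕ.^ (B ℕ.* A)
  regroup′ x A B = trans (regroup x A B) (cong ((x ℕ.^ K) ℕ.^_) (ℕ.*-comm A B))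

toℚᵘ-/1 : ∀ i → ℚ.toℚᵘ (i / 1) ℚᵘ.≃ ℚᵘ.mkℚᵘ i 0
toℚᵘ-/1 i = ℚ.toℚᵘ-fromℚᵘ (ℚᵘ.mkℚᵘ i 0)

/1-injective-≤ : ∀ {i j} → i / 1 ≤ j / 1 → i ℤ.≤ j
/1-injective-≤ {i} {j} h = subst₂ ℤ._≤_ (ℤ.*-identityʳ i) (ℤ.*-identityʳ j)
  (ℚᵘ.drop-*≤* (ℚᵘ.≤-respˡ-≃ (toℚᵘ-/1 i) (ℚᵘ.≤-respʳ-≃ (toℚᵘ-/1 j) (ℚ.toℚᵘ-mono-≤ h))))

/1-mono-≤ : ∀ {i j} → i ℤ.≤ j → i / 1 ≤ j / 1
/1-mono-≤ {i} {j} h = ℚ.toℚᵘ-cancel-≤ (ℚᵘ.≤-respˡ-≃ (ℚᵘ.≃-sym (toℚᵘ-/1 i)) (ℚᵘ.≤-respʳ-≃ (ℚᵘ.≃-sym (toℚᵘ-/1 j))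
  (ℚᵘ.*≤* (subst₂ ℤ._≤_ (sym (ℤ.*-identityʳ i)) (sym (ℤ.*-identityʳ j)) h))))

/1-+ : ∀ i j → (i ℤ.+ j) / 1 ≡ i / 1 + j / 1
/1-+ i j = ℚ.toℚᵘ-injective {(i ℤ.+ j) / 1} {i / 1 + j / 1} (begin
  ℚ.toℚᵘ ((i ℤ.+ j) / 1)                        ≈⟨ toℚᵘ-/1 (i ℤ.+ j) ⟩
  ℚᵘ.mkℚᵘ (i ℤ.+ j) 0                            ≈⟨ ℚᵘ.*≡* (cong (ℤ._* ℤ.+ 1) (sym (cong₂ ℤ._+_ (ℤ.*-identityʳ i) (ℤ.*-identityʳ j)))) ⟩
  ℚᵘ.mkℚᵘ i 0 ℚᵘ.+ ℚᵘ.mkℚᵘ j 0                    ≈⟨ ℚᵘ.+-cong {ℚ.toℚᵘ (i / 1)} {ℚᵘ.mkℚᵘ i 0} {ℚ.toℚᵘ (j / 1)} {ℚᵘ.mkℚᵘ j 0} (toℚᵘ-/1 i) (toℚᵘ-/1 j) ⟨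
  ℚ.toℚᵘ (i / 1) ℚᵘ.+ ℚ.toℚᵘ (j / 1)              ≈⟨ ℚ.toℚᵘ-homo-+ (i / 1) (j / 1) ⟨
  ℚ.toℚᵘ (i / 1 + j / 1)                         ∎)
  where open ℚᵘ.≃-Reasoning

/1-* : ∀ i j → (i ℤ.* j) / 1 ≡ (i / 1) * (j / 1)
/1-* i j = ℚ.toℚᵘ-injective {(i ℤ.* j) / 1} {(i / 1) * (j / 1)} (begin
  ℚ.toℚᵘ ((i ℤ.* j) / 1)                        ≈⟨ toℚᵘ-/1 (i ℤ.* j) ⟩
  ℚᵘ.mkℚᵘ i 0 ℚᵘ.* ℚᵘ.mkℚᵘ j 0                    ≈⟨ ℚᵘ.*-cong {ℚ.toℚᵘ (i / 1)} {ℚᵘ.mkℚᵘ i 0} {ℚ.toℚᵘ (j / 1)} {ℚᵘ.mkℚᵘ j 0} (toℚᵘ-/1 i) (toℚᵘ-/1 j) ⟨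
  ℚ.toℚᵘ (i / 1) ℚᵘ.* ℚ.toℚᵘ (j / 1)              ≈⟨ ℚ.toℚᵘ-homo-* (i / 1) (j / 1) ⟨
  ℚ.toℚᵘ ((i / 1) * (j / 1))                     ∎)
  where open ℚᵘ.≃-Reasoning

/1-neg : ∀ i → (ℤ.- i) / 1 ≡ - (i / 1)
/1-neg i = ℚ.toℚᵘ-injective {(ℤ.- i) / 1} { - (i / 1)} (begin
  ℚ.toℚᵘ ((ℤ.- i) / 1)       ≈⟨ toℚᵘ-/1 (ℤ.- i) ⟩
  ℚᵘ.- ℚᵘ.mkℚᵘ i 0           ≈⟨ ℚᵘ.-‿cong {ℚ.toℚᵘ (i / 1)} {ℚᵘ.mkℚᵘ i 0} (toℚᵘ-/1 i) ⟨
  ℚᵘ.- ℚ.toℚᵘ (i / 1)        ≈⟨ ℚ.toℚᵘ-homo‿- (i / 1) ⟨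
  ℚ.toℚᵘ (- (i / 1))         ∎)
  where open ℚᵘ.≃-Reasoning

ι-+ : ∀ m n → ι (m ℕ.+ n) ≡ ι m + ι n
ι-+ m n = /1-+ (ℤ.+ m) (ℤ.+ n)

ι-* : ∀ m n → ι (m ℕ.* n) ≡ ι m * ι n
ι-* m n = trans (cong (_/ 1) (ℤ.pos-* m n)) (/1-* (ℤ.+ m) (ℤ.+ n))

ι-mono-≤ : ∀ {m n} → m ℕ.≤ n → ι m ≤ ι n
ι-mono-≤ h = /1-mono-≤ (ℤ.+≤+ h)

ι-cancel-≤ : ∀ {m n} → ι m ≤ ι n → m ℕ.≤ n
ι-cancel-≤ h = ℤ.drop‿+≤+ (/1-injective-≤ h)

ι-pos : ∀ n → 0ℚ < ι (suc n)
ι-pos n = ℚ.<-≤-trans 0<1 (ι-mono-≤ {1} {suc n} (ℕ.s≤s ℕ.z≤n))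

⊖-/1 : ∀ m n → (m ⊖ n) / 1 ≡ ι m - ι n
⊖-/1 m n = trans (cong (_/ 1) (sym (ℤ.m-n≡m⊖n m n)))
  (trans (/1-+ (ℤ.+ m) (ℤ.- ℤ.+ n)) (cong (ι m +_) (/1-neg (ℤ.+ n))))

i/n*n≡i : ∀ i n → (i / suc n) * ι (suc n) ≡ i / 1
i/n*n≡i i n = ℚ.toℚᵘ-injective (ℚᵘ.≃-trans (ℚ.toℚᵘ-homo-* (i / suc n) (ι (suc n)))
  (ℚᵘ.≃-trans (ℚᵘ.*-cong (ℚ.toℚᵘ-fromℚᵘ (ℚᵘ.mkℚᵘ i n)) (toℚᵘ-/1 (ℤ.+ suc n)))
  (ℚᵘ.≃-trans (ℚᵘ.*≡* (trans (ℤ.*-identityʳ _) (cong (i ℤ.*_) (cong (λ z → ℤ.+ suc z) (sym (ℕ.*-identityʳ n))))))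
    (ℚᵘ.≃-sym (toℚᵘ-/1 i)))))

q*↧q≡↥q : ∀ q → q * ι (↧ₙ q) ≡ ↥ q / 1
q*↧q≡↥q q@(mkℚ i n _) = trans (cong (_* ι (suc n)) (sym (ℚ.↥p/↧p≡p q))) (i/n*n≡i i n)

∣↥∣ : ∀ {q} → 0ℚ < q → ℤ.+ ℤ.∣ ↥ q ∣ ≡ ↥ q
∣↥∣ {q@(mkℚ i n _)} 0<q = ℤ.0≤i⇒+∣i∣≡i (ℤ.nonNegative⁻¹ i {{ℚ.pos⇒nonNeg q {{positive 0<q}}}})

∣↥∣-nonZero : ∀ {q} → 0ℚ < q → ℕ.NonZero ℤ.∣ ↥ q ∣
∣↥∣-nonZero {q@(mkℚ _ _ _)} 0<q = ℚ.pos⇒nonZero q {{positive 0<q}}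

cross : ∀ u w x y → 0ℚ < x → 0ℚ < y → ι u * x ≤ ι w * y →
        u ℕ.* (ℤ.∣ ↥ x ∣ ℕ.* ↧ₙ y) ℕ.≤ w ℕ.* (ℤ.∣ ↥ y ∣ ℕ.* ↧ₙ x)
cross u w x y 0<x 0<y h = ι-cancel-≤ (≤-trans (≤-reflexive (lhs u x (↧ₙ y) 0<x))
  (≤-trans (mul (ι (↧ₙ x) * ι (↧ₙ y)) h)
  (≤-trans (≤-reflexive (solve 4 (λ w y a b → w :* y :* (a :* b) := w :* y :* (b :* a)) refl (ι w) y (ι (↧ₙ x)) (ι (↧ₙ y))))
           (≤-reflexive (sym (lhs w y (↧ₙ x) 0<y))))))
  where
  mul : ∀ {p q} r → {{NonNegative r}} → p ≤ q → p * r ≤ q * r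
  mul r = ℚ.*-monoʳ-≤-nonNeg r
  instance
    nn : NonNegative (ι (↧ₙ x) * ι (↧ₙ y))
    nn = nonNegative (≤-trans (ι-mono-≤ {0} {↧ₙ x ℕ.* ↧ₙ y} ℕ.z≤n) (≤-reflexive (ι-* (↧ₙ x) (↧ₙ y))))
  lhs : ∀ u x d → 0ℚ < x → ι (u ℕ.* (ℤ.∣ ↥ x ∣ ℕ.* d)) ≡ ι u * x * (ι (↧ₙ x) * ι d)
  lhs u x d 0<x = trans (ι-* u _) (trans (cong (ι u *_) (trans (ι-* ℤ.∣ ↥ x ∣ d)
    (cong (_* ι d) (trans (cong (_/ 1) (∣↥∣ 0<x)) (sym (q*↧q≡↥q x))))))
    (solve 4 (λ u x e d → u :* (x :* e :* d) := u :* x :* (e :* d)) refl (ι u) x (ι (↧ₙ x)) (ι d)))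

log₂-approx-≤ : ∀ k m n x y → 0ℚ < x → 0ℚ < y → ι (suc (k ℕ.+ k)) * x ≤ ι (suc k ℕ.+ suc k) * y →
  log₂-approx m x ≤ log₂-approx n y + (ℤ.+ 1 / suc k + (ℤ.+ 1 / suc m + ℤ.+ 1 / suc n))
log₂-approx-≤ k m n x y 0<x 0<y h = ℚ.*-cancelʳ-≤-pos (κ * (μ * ν)) {{positive 0<κμν}} (≤-trans (≤-reflexive left)
  (≤-trans (ℚ.+-monoˡ-≤ (- (B * (ν * κ)) - B′ * (μ * κ)) ineq) (≤-reflexive (sym right))))
  where
  K = suc k
  M = suc m
  N = suc n
  p = ℤ.∣ ↥ x ∣
  p′ = ℤ.∣ ↥ y ∣
  instance
    nz : ℕ.NonZero p
    nz = ∣↥∣-nonZero 0<x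
    nz′ : ℕ.NonZero p′
    nz′ = ∣↥∣-nonZero 0<y
  a = ⌊log₂ p ℕ.^ M ⌋
  b = ⌊log₂ ↧ₙ x ℕ.^ M ⌋
  a′ = ⌊log₂ p′ ℕ.^ N ⌋
  b′ = ⌊log₂ ↧ₙ y ℕ.^ N ⌋
  κ = ι K
  μ = ι M
  ν = ι N
  A = ι a
  B = ι b
  A′ = ι a′
  B′ = ι b′
  natural : a ℕ.* (N ℕ.* K) ℕ.+ b′ ℕ.* (M ℕ.* K) ℕ.≤ M ℕ.* N ℕ.+ (suc a′ ℕ.* (M ℕ.* K) ℕ.+ suc b ℕ.* (N ℕ.* K))
  natural = log-compare K M N p (↧ₙ x) p′ (↧ₙ y)
    (ratio-power k (k ℕ.+ suc k) (p ℕ.* ↧ₙ y) (p′ ℕ.* ↧ₙ x) refl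
      (subst (λ z → z ℕ.* (p ℕ.* ↧ₙ y) ℕ.≤ (K ℕ.+ K) ℕ.* (p′ ℕ.* ↧ₙ x)) (sym (ℕ.+-suc k k)) (cross (suc (k ℕ.+ k)) (K ℕ.+ K) x y 0<x 0<y h)))
  ι3 : ∀ i j l → ι (i ℕ.* (j ℕ.* l)) ≡ ι i * (ι j * ι l)
  ι3 i j l = trans (ι-* i (j ℕ.* l)) (cong (ι i *_) (ι-* j l))
  ineq : A * (ν * κ) + B′ * (μ * κ) ≤ μ * ν + ((1ℚ + A′) * (μ * κ) + (1ℚ + B) * (ν * κ))
  ineq = subst₂ _≤_
    (trans (ι-+ (a ℕ.* (N ℕ.* K)) (b′ ℕ.* (M ℕ.* K))) (cong₂ _+_ (ι3 a N K) (ι3 b′ M K)))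
    (trans (ι-+ (M ℕ.* N) _) (cong₂ _+_ (ι-* M N)
      (trans (ι-+ (suc a′ ℕ.* (M ℕ.* K)) (suc b ℕ.* (N ℕ.* K)))
        (cong₂ _+_ (trans (ι3 (suc a′) M K) (cong (_* (μ * κ)) (ι-+ 1 a′)))
                   (trans (ι3 (suc b) N K) (cong (_* (ν * κ)) (ι-+ 1 b)))))))
    (ι-mono-≤ natural)
  0<κμν : 0ℚ < κ * (μ * ν)
  0<κμν = subst (0ℚ <_) (ι3 K M N) (ι-pos (ℕ.pred (K ℕ.* (M ℕ.* N))))
  X Y κ⁻¹ μ⁻¹ ν⁻¹ : ℚ
  X = log₂-approx m x
  Y = log₂-approx n y
  κ⁻¹ = ℤ.+ 1 / K
  μ⁻¹ = ℤ.+ 1 / M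
  ν⁻¹ = ℤ.+ 1 / N
  Xμ : X * μ ≡ A - B
  Xμ = trans (i/n*n≡i (a ⊖ b) m) (⊖-/1 a b)
  Yν : Y * ν ≡ A′ - B′
  Yν = trans (i/n*n≡i (a′ ⊖ b′) n) (⊖-/1 a′ b′)
  left : X * (κ * (μ * ν)) ≡ A * (ν * κ) + B′ * (μ * κ) + (- (B * (ν * κ)) - B′ * (μ * κ))
  left = trans (solve 4 (λ X κ μ ν → X :* (κ :* (μ :* ν)) := (X :* μ) :* (ν :* κ)) refl X κ μ ν)
    (trans (cong (_* (ν * κ)) Xμ)
      (solve 6 (λ A B B′ κ μ ν → (A :- B) :* (ν :* κ) := A :* (ν :* κ) :+ B′ :* (μ :* κ) :+ (:- (B :* (ν :* κ)) :- B′ :* (μ :* κ)))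
        refl A B B′ κ μ ν))
  right : (Y + (κ⁻¹ + (μ⁻¹ + ν⁻¹))) * (κ * (μ * ν)) ≡
          μ * ν + ((1ℚ + A′) * (μ * κ) + (1ℚ + B) * (ν * κ)) + (- (B * (ν * κ)) - B′ * (μ * κ))
  right = trans
    (solve 7 (λ Y κ⁻¹ μ⁻¹ ν⁻¹ κ μ ν → (Y :+ (κ⁻¹ :+ (μ⁻¹ :+ ν⁻¹))) :* (κ :* (μ :* ν)) :=
        (Y :* ν) :* (μ :* κ) :+ ((κ⁻¹ :* κ) :* (μ :* ν) :+ ((μ⁻¹ :* μ) :* (ν :* κ) :+ (ν⁻¹ :* ν) :* (μ :* κ))))
      refl Y κ⁻¹ μ⁻¹ ν⁻¹ κ μ ν)
    (trans (cong₂ _+_ (cong (_* (μ * κ)) Yν) (cong₂ _+_ (cong (_* (μ * ν)) (i/n*n≡i (ℤ.+ 1) k))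
             (cong₂ _+_ (cong (_* (ν * κ)) (i/n*n≡i (ℤ.+ 1) m)) (cong (_* (μ * κ)) (i/n*n≡i (ℤ.+ 1) n)))))
      (solve 6 (λ A′ B B′ κ μ ν →
          (A′ :- B′) :* (μ :* κ) :+ (con 1ℚ :* (μ :* ν) :+ (con 1ℚ :* (ν :* κ) :+ con 1ℚ :* (μ :* κ))) :=
          μ :* ν :+ ((con 1ℚ :+ A′) :* (μ :* κ) :+ (con 1ℚ :+ B) :* (ν :* κ)) :+ (:- (B :* (ν :* κ)) :- B′ :* (μ :* κ)))
        refl A′ B B′ κ μ ν))

archimedean : ∀ ε → 0ℚ < ε → ∃[ k ] ∀ m n → k ℕ.≤ m → k ℕ.≤ n →
  ℤ.+ 1 / suc k + (ℤ.+ 1 / suc m + ℤ.+ 1 / suc n) ≤ ε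
archimedean ε 0<ε = k , λ m n k≤m k≤n → ≤-trans
    (ℚ.+-monoʳ-≤ r (ℚ.+-mono-≤ (anti k≤m) (anti k≤n))) 3r≤ε
  where
  d = ↧ₙ ε
  k = 3 ℕ.* d
  r = ℤ.+ 1 / suc k
  anti : ∀ {m} → k ℕ.≤ m → ℤ.+ 1 / suc m ≤ r
  anti {m} k≤m = ℚ.*-cancelʳ-≤-pos (ι (suc m) * ι (suc k)) {{positive (subst (0ℚ <_) (ι-* (suc m) (suc k)) (ι-pos (ℕ.pred (suc m ℕ.* suc k))))}}
    (subst₂ _≤_
      (trans (sym (ℚ.*-identityˡ _)) (trans (cong (_* ι (suc k)) (sym (i/n*n≡i (ℤ.+ 1) m))) (ℚ.*-assoc (ℤ.+ 1 / suc m) (ι (suc m)) (ι (suc k)))))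
      (trans (sym (ℚ.*-identityˡ _)) (trans (cong (_* ι (suc m)) (sym (i/n*n≡i (ℤ.+ 1) k)))
        (solve 3 (λ a b c → a :* b :* c := a :* (c :* b)) refl r (ι (suc k)) (ι (suc m)))))
      (ι-mono-≤ (ℕ.s≤s k≤m)))
  1≤εd : 1ℚ ≤ ε * ι d
  1≤εd = ≤-trans (ι-mono-≤ {1} {ℤ.∣ ↥ ε ∣} (ℕ.>-nonZero⁻¹ _ {{∣↥∣-nonZero 0<ε}}))
    (≤-reflexive (trans (cong (_/ 1) (∣↥∣ 0<ε)) (sym (q*↧q≡↥q ε))))
  3r≤ε : r + (r + r) ≤ ε
  3r≤ε = ℚ.*-cancelʳ-≤-pos (ι (suc k)) {{positive (ι-pos k)}} (≤-trans (≤-reflexive eq)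
    (≤-trans (ℚ.*-monoˡ-≤-nonNeg (ι 3) 1≤εd) (≤-trans (≤-reflexive eq′)
    (ℚ.*-monoˡ-≤-nonNeg ε {{nonNegative (ℚ.<⇒≤ 0<ε)}} (ι-mono-≤ (ℕ.n≤1+n k))))))
    where
    eq : (r + (r + r)) * ι (suc k) ≡ ι 3 * 1ℚ
    eq = trans (solve 2 (λ r s → (r :+ (r :+ r)) :* s := r :* s :+ (r :* s :+ r :* s)) refl r (ι (suc k)))
               (cong (λ z → z + (z + z)) (i/n*n≡i (ℤ.+ 1) k))
    eq′ : ι 3 * (ε * ι d) ≡ ε * ι k
    eq′ = trans (solve 3 (λ a e b → a :* (e :* b) := e :* (a :* b)) refl (ι 3) ε (ι d)) (cong (ε *_) (sym (ι-* 3 d)))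

shift-ratio : ∀ k c δ p q → ι (suc k ℕ.+ suc k) * δ ≡ c → c ≤ p → p ≤ q + δ → ι (suc (k ℕ.+ k)) * p ≤ ι (suc k ℕ.+ suc k) * q
shift-ratio k c δ p q eq c≤p p≤q+δ = ≤-trans
  (≤-reflexive (solve 2 (λ u p → u :* p := (con 1ℚ :+ u) :* p :- p) refl u p))
  (≤-trans (ℚ.+-mono-≤
     (≤-trans (≤-reflexive (cong (_* p) (trans (sym (ι-+ 1 (suc (k ℕ.+ k)))) (cong ι (cong suc (sym (ℕ.+-suc k k)))))))
       (ℚ.*-monoˡ-≤-nonNeg w {{nonNegative (ℚ.<⇒≤ (ι-pos (k ℕ.+ suc k)))}} p≤q+δ))
     (ℚ.neg-antimono-≤ c≤p))
  (≤-reflexive (trans (cong (λ z → w * (q + δ) - z) (sym eq))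
    (solve 3 (λ w q d → w :* (q :+ d) :- w :* d := w :* q) refl w q δ))))
  where
  u = ι (suc (k ℕ.+ k))
  w = ι (suc k ℕ.+ suc k)

abstract

  log₂-cauchy : ∀ x → Cauchy x → (∃[ δ ] 0ℚ < δ × Eventually λ n → 0ℚ + δ ≤ x n) → Cauchy (λ n → log₂-approx n (x n))
  log₂-cauchy x cx (c , 0<c , N₀ , lower) ε 0<ε =
    let k , small = archimedean ε 0<ε
        δ , 0<δ , eq = scale (ι (suc k ℕ.+ suc k)) c (ι-pos (k ℕ.+ suc k)) 0<c
        N₁ , close = cx δ 0<δ
        L = N₀ ℕ.⊔ (N₁ ℕ.⊔ k)
        to₀ : ∀ {n} → L ℕ.≤ n → N₀ ℕ.≤ n
        to₀ = ℕ.m⊔n≤o⇒m≤o N₀ (N₁ ℕ.⊔ k)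
        to₁ : ∀ {n} → L ℕ.≤ n → N₁ ℕ.≤ n
        to₁ = ℕ.m⊔n≤o⇒m≤o N₁ k ∘ ℕ.m⊔n≤o⇒n≤o N₀ (N₁ ℕ.⊔ k)
        to₂ : ∀ {n} → L ℕ.≤ n → k ℕ.≤ n
        to₂ = ℕ.m⊔n≤o⇒n≤o N₁ k ∘ ℕ.m⊔n≤o⇒n≤o N₀ (N₁ ℕ.⊔ k)
        one : ∀ m n → L ℕ.≤ m → L ℕ.≤ n → log₂-approx m (x m) ≤ log₂-approx n (x n) + ε
        one m n hm hn = ≤-trans
          (log₂-approx-≤ k m n (x m) (x n) (pos m (to₀ hm)) (pos n (to₀ hn))
            (shift-ratio k c δ (x m) (x n) eq (c≤ m (to₀ hm)) (∣p-q∣≤r⇒p≤q+r (close m n (to₁ hm) (to₁ hn)))))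
          (ℚ.+-monoʳ-≤ (log₂-approx n (x n)) (small m n (to₂ hm) (to₂ hn)))
    in L , λ m n hm hn → ∣p-q∣≤ (one m n hm hn) (one n m hn hm)
    where
    c≤ : ∀ n → N₀ ℕ.≤ n → c ≤ x n
    c≤ n h = ≤-trans (≤-reflexive (sym (ℚ.+-identityˡ c))) (lower n h)
    pos : ∀ n → N₀ ℕ.≤ n → 0ℚ < x n
    pos n h = ℚ.<-≤-trans 0<c (c≤ n h)

log₂ : (x : ℝ) → 0ᴿ <ᴿ x → ℝ
log₂ (mkℝ x cx) 0<x = mkℝ (λ n → log₂-approx n (x n)) (log₂-cauchy x cx 0<x)

Cube : ℕ → Set
Cube N = Vec Bool N

infixl 6 _⊕_

_⊕_ : ∀ {N} → Cube N → Cube N → Cube N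
_⊕_ = Vec.zipWith _xor_

𝟎 : ∀ {N} → Cube N
𝟎 = Vec.replicate _ false

-- Over 𝔽₂ closure under scalar multiplication is automatic.
IsLinear : ∀ {N} → (Cube N → Bool) → Set
IsLinear V = T (V 𝟎) × (∀ x y → T (V x) → T (V y) → T (V (x ⊕ y)))

-- S = a ⊕ V for a linear subspace V, which is then { v ∣ a ⊕ v ∈ S }.
IsAffine : ∀ {N} → (Cube N → Bool) → Set
IsAffine S = ∃[ a ] IsLinear (λ v → S (a ⊕ v))

cube : ∀ N → List (Cube N)
cube zero    = [] ∷ []
cube (suc N) = map (false ∷_) (cube N) ++ map (true ∷_) (cube N)

glue : ∀ {N} → (Cube N → Bool) → (Cube N → Bool) → Cube (suc N) → Bool
glue S₀ S₁ (false ∷ x) = S₀ x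
glue S₀ S₁ (true  ∷ x) = S₁ x

subsets : ∀ N → List (Cube N → Bool)
subsets zero    = (λ _ → false) ∷ (λ _ → true) ∷ []
subsets (suc N) = cartesianProductWith glue (subsets N) (subsets N)

all? : ∀ {N} {P : Cube N → Set} → (∀ x → Dec (P x)) → Dec (∀ x → P x)
all? {zero}  P? = map′ (λ { p [] → p }) (λ h → h []) (P? [])
all? {suc N} P? = map′ (λ { (p , q) (false ∷ x) → p x ; (p , q) (true ∷ x) → q x })
                       (λ h → (λ x → h (false ∷ x)) , (λ x → h (true ∷ x)))
                       (all? (λ x → P? (false ∷ x)) ×-dec all? (λ x → P? (true ∷ x)))

any? : ∀ {N} {P : Cube N → Set} → (∀ x → Dec (P x)) → Dec (∃ P)
any? {zero}  P? = map′ (λ p → [] , p) (λ { ([] , p) → p }) (P? [])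
any? {suc N} P? = map′ (λ { (inj₁ (x , p)) → false ∷ x , p ; (inj₂ (x , p)) → true ∷ x , p })
                       (λ { (false ∷ x , p) → inj₁ (x , p) ; (true ∷ x , p) → inj₂ (x , p) })
                       (any? (λ x → P? (false ∷ x)) ⊎-dec any? (λ x → P? (true ∷ x)))

affine? : ∀ {N} (S : Cube N → Bool) → Dec (IsAffine S)
affine? S = any? λ a → T? (S (a ⊕ 𝟎)) ×-dec
  all? λ x → all? λ y → T? (S (a ⊕ x)) →-dec (T? (S (a ⊕ y)) →-dec T? (S (a ⊕ (x ⊕ y))))

affineSubspaces : ∀ N → List (Cube N → Bool)
affineSubspaces N = filter affine? (subsets N)

subsets-complete : ∀ {N} (S : Cube N → Bool) → ∃[ S′ ] S′ ∈ subsets N × S ≗ S′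
subsets-complete {zero} S with S [] in eq
... | false = (λ _ → false) , here refl , λ { [] → eq }
... | true  = (λ _ → true) , there (here refl) , λ { [] → eq }
subsets-complete {suc N} S =
  let S₀ , S₀∈ , eq₀ = subsets-complete (λ x → S (false ∷ x))
      S₁ , S₁∈ , eq₁ = subsets-complete (λ x → S (true ∷ x))
  in glue S₀ S₁ , ∈-cartesianProductWith⁺ glue S₀∈ S₁∈ ,
     λ { (false ∷ x) → eq₀ x ; (true ∷ x) → eq₁ x }

affine-resp : ∀ {N} {S S′ : Cube N → Bool} → S ≗ S′ → IsAffine S → IsAffine S′
affine-resp eq (a , z , c) = a , subst T (eq _) z , λ x y p q →
  subst T (eq _) (c x y (subst T (sym (eq _)) p) (subst T (sym (eq _)) q))

affineSubspaces-complete : ∀ {N} (S : Cube N → Bool) → IsAffine S → ∃[ S′ ] S′ ∈ affineSubspaces N × S ≗ S′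
affineSubspaces-complete S aff = let S′ , S′∈ , eq = subsets-complete S in
  S′ , ∈-filter⁺ affine? S′∈ (affine-resp eq aff) , eq

affineSubspaces-sound : ∀ {N} {S : Cube N → Bool} → S ∈ affineSubspaces N → IsAffine S
affineSubspaces-sound {N} S∈ = proj₂ (∈-filter⁻ affine? {xs = subsets N} S∈)

singleton : ∀ {N} → Cube N → Cube N → Bool
singleton []          []          = true
singleton (false ∷ a) (false ∷ x) = singleton a x
singleton (false ∷ a) (true  ∷ x) = false
singleton (true  ∷ a) (false ∷ x) = false
singleton (true  ∷ a) (true  ∷ x) = singleton a x

singleton-affine : ∀ {N} (a : Cube N) → IsAffine (singleton a)
singleton-affine a = a , zero∈ a , sum∈ a
  where
  zero∈ : ∀ {N} (a : Cube N) → T (singleton a (a ⊕ 𝟎))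
  zero∈ []          = tt
  zero∈ (false ∷ a) = zero∈ a
  zero∈ (true  ∷ a) = zero∈ a
  sum∈ : ∀ {N} (a x y : Cube N) → T (singleton a (a ⊕ x)) → T (singleton a (a ⊕ y)) → T (singleton a (a ⊕ (x ⊕ y)))
  sum∈ []          []          []          _ _ = tt
  sum∈ (false ∷ a) (false ∷ x) (false ∷ y) p q = sum∈ a x y p q
  sum∈ (true  ∷ a) (false ∷ x) (false ∷ y) p q = sum∈ a x y p q
  sum∈ (false ∷ a) (false ∷ x) (true  ∷ y) p ()
  sum∈ (false ∷ a) (true  ∷ x) _           () q
  sum∈ (true  ∷ a) (false ∷ x) (true  ∷ y) p ()
  sum∈ (true  ∷ a) (true  ∷ x) _           () q

Σᴿ : ∀ {A : Set} → List A → (A → ℝ) → ℝ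
Σᴿ []       F = 0ᴿ
Σᴿ (x ∷ xs) F = F x +ᴿ Σᴿ xs F

record Distribution (N : ℕ) : Set where
  field
    pmf        : Cube N → ℝ
    pmf-nonneg : ∀ x → 0ᴿ ≤ᴿ pmf x
    pmf-total  : Σᴿ (cube N) pmf ≃ᴿ 1ᴿ

open Distribution public

infix 9 [-1]^_

[-1]^_ : Bool → ℝ
[-1]^ false = 1ᴿ
[-1]^ true  = -ᴿ 1ᴿ

bias : ∀ {N} → (Cube N → Bool) → Distribution N → (Cube N → Bool) → ℝ
bias {N} g ν S = ∣ Σᴿ (filterᵇ S (cube N)) (λ x → [-1]^ (g x) *ᴿ pmf ν x) ∣ᴿ

-- Biases are nonnegative and there is at least one affine subspace, so the
-- initial value 0 does not affect the maximum.
maxBias : ∀ {N} → (Cube N → Bool) → Distribution N → ℝ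
maxBias {N} g ν = foldr _⊔ᴿ_ 0ᴿ (map (bias g ν) (affineSubspaces N))

Σℚ : ∀ {A : Set} → List A → (A → ℚ) → ℚ
Σℚ []       F = 0ℚ
Σℚ (x ∷ xs) F = F x + Σℚ xs F

seq-Σᴿ : ∀ {A : Set} (xs : List A) (F : A → ℝ) i → seq (Σᴿ xs F) i ≡ Σℚ xs (λ x → seq (F x) i)
seq-Σᴿ []       F i = refl
seq-Σᴿ (x ∷ xs) F i = cong (seq (F x) i +_) (seq-Σᴿ xs F i)

Σℚ-cong : ∀ {A : Set} (xs : List A) {F G : A → ℚ} → F ≗ G → Σℚ xs F ≡ Σℚ xs G
Σℚ-cong []       eq = refl
Σℚ-cong (x ∷ xs) eq = cong₂ _+_ (eq x) (Σℚ-cong xs eq)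

Σℚ-++ : ∀ {A : Set} (xs ys : List A) (F : A → ℚ) → Σℚ (xs ++ ys) F ≡ Σℚ xs F + Σℚ ys F
Σℚ-++ []       ys F = sym (ℚ.+-identityˡ _)
Σℚ-++ (x ∷ xs) ys F = trans (cong (F x +_) (Σℚ-++ xs ys F)) (sym (ℚ.+-assoc (F x) (Σℚ xs F) (Σℚ ys F)))

Σℚ-map : ∀ {A B : Set} (h : A → B) (xs : List A) (F : B → ℚ) → Σℚ (map h xs) F ≡ Σℚ xs (λ x → F (h x))
Σℚ-map h []       F = refl
Σℚ-map h (x ∷ xs) F = cong (F (h x) +_) (Σℚ-map h xs F)

Σℚ-*ˡ : ∀ {A : Set} (xs : List A) c (F : A → ℚ) → Σℚ xs (λ x → c * F x) ≡ c * Σℚ xs F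
Σℚ-*ˡ []       c F = sym (ℚ.*-zeroʳ c)
Σℚ-*ˡ (x ∷ xs) c F = trans (cong (c * F x +_) (Σℚ-*ˡ xs c F)) (sym (ℚ.*-distribˡ-+ c (F x) (Σℚ xs F)))

Σℚ-zero : ∀ {A : Set} (xs : List A) → Σℚ xs (λ _ → 0ℚ) ≡ 0ℚ
Σℚ-zero []       = refl
Σℚ-zero (x ∷ xs) = trans (ℚ.+-identityˡ _) (Σℚ-zero xs)

Σℚ-filterᵇ : ∀ {A : Set} (S : A → Bool) (xs : List A) (F : A → ℚ) →
             Σℚ (filterᵇ S xs) F ≡ Σℚ xs (λ x → if S x then F x else 0ℚ)
Σℚ-filterᵇ S []       F = refl
Σℚ-filterᵇ S (x ∷ xs) F with S x
... | true  = cong (F x +_) (Σℚ-filterᵇ S xs F)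
... | false = trans (Σℚ-filterᵇ S xs F) (sym (ℚ.+-identityˡ _))

Σℚ-cube : ∀ N (F : Cube (suc N) → ℚ) →
          Σℚ (cube (suc N)) F ≡ Σℚ (cube N) (λ x → F (false ∷ x)) + Σℚ (cube N) (λ x → F (true ∷ x))
Σℚ-cube N F = trans (Σℚ-++ (map (false ∷_) (cube N)) (map (true ∷_) (cube N)) F)
  (cong₂ _+_ (Σℚ-map (false ∷_) (cube N) F) (Σℚ-map (true ∷_) (cube N) F))

Σℚ-singleton : ∀ {N} (a : Cube N) (F : Cube N → ℚ) → Σℚ (cube N) (λ x → if singleton a x then F x else 0ℚ) ≡ F a
Σℚ-singleton []              F = ℚ.+-identityʳ _
Σℚ-singleton {suc N} (false ∷ a) F = trans (Σℚ-cube N (λ x → if singleton (false ∷ a) x then F x else 0ℚ)) (trans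
  (cong₂ _+_ (Σℚ-singleton a (λ x → F (false ∷ x))) (Σℚ-zero (cube N))) (ℚ.+-identityʳ _))
Σℚ-singleton {suc N} (true ∷ a) F = trans (Σℚ-cube N (λ x → if singleton (true ∷ a) x then F x else 0ℚ)) (trans
  (cong₂ _+_ (Σℚ-zero (cube N)) (Σℚ-singleton a (λ x → F (true ∷ x)))) (ℚ.+-identityˡ _))

seq-bias : ∀ {N} (g : Cube N → Bool) ν S i →
  seq (bias g ν S) i ≡ ∣ Σℚ (cube N) (λ x → if S x then seq ([-1]^ (g x) *ᴿ pmf ν x) i else 0ℚ) ∣
seq-bias {N} g ν S i = cong ∣_∣ (trans (seq-Σᴿ (filterᵇ S (cube N)) _ i) (Σℚ-filterᵇ S (cube N) _))

seq-bias-cong : ∀ {N} (g : Cube N → Bool) ν {S S′} → S ≗ S′ → ∀ i → seq (bias g ν S) i ≡ seq (bias g ν S′) i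
seq-bias-cong {N} g ν {S} {S′} eq i = trans (seq-bias g ν S i) (trans
  (cong ∣_∣ (Σℚ-cong (cube N) λ x → cong (λ b → if b then seq ([-1]^ (g x) *ᴿ pmf ν x) i else 0ℚ) (eq x)))
  (sym (seq-bias g ν S′ i)))

seq-bias≤maxBias : ∀ {N} (g : Cube N → Bool) ν S → IsAffine S → ∀ i → seq (bias g ν S) i ≤ seq (maxBias g ν) i
seq-bias≤maxBias {N} g ν S aff i =
  let S′ , S′∈ , eq = affineSubspaces-complete S aff in
  ≤-trans (≤-reflexive (seq-bias-cong g ν eq i)) (≤-foldr (affineSubspaces N) S′∈)
  where
  ≤-foldr : ∀ Ss {S} → S ∈ Ss → seq (bias g ν S) i ≤ seq (foldr _⊔ᴿ_ 0ᴿ (map (bias g ν) Ss)) i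
  ≤-foldr (S ∷ Ss) (here refl) = ℚ.p≤p⊔q (seq (bias g ν S) i) _
  ≤-foldr (S ∷ Ss) (there S∈)  = ≤-trans (≤-foldr Ss S∈) (ℚ.p≤q⊔p (seq (bias g ν S) i) _)

bias≤maxBias : ∀ {N} (g : Cube N → Bool) ν S → IsAffine S → bias g ν S ≤ᴿ maxBias g ν
bias≤maxBias g ν S aff = ≤ᴿ-pointwise {bias g ν S} {maxBias g ν} (seq-bias≤maxBias g ν S aff)

maxBias-least : ∀ {N} (g : Cube N → Bool) ν B → (∀ S → IsAffine S → bias g ν S ≤ᴿ B) → maxBias g ν ≤ᴿ B
maxBias-least {N} g ν B h = go (affineSubspaces N) affineSubspaces-sound
  where
  S₀ : Cube N → Bool
  S₀ = singleton 𝟎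
  go : ∀ Ss → (∀ {S} → S ∈ Ss → IsAffine S) → foldr _⊔ᴿ_ 0ᴿ (map (bias g ν) Ss) ≤ᴿ B
  go [] _ = ≤ᴿ-trans {0ᴿ} {bias g ν S₀} {B}
    (≤ᴿ-pointwise {0ᴿ} {bias g ν S₀} (λ i → ≤-trans (ℚ.0≤∣p∣ _) (≤-reflexive (sym (seq-bias g ν S₀ i)))))
    (h S₀ (singleton-affine 𝟎))
  go (S ∷ Ss) aff ε 0<ε = eventually-× ℚ.⊔-lub (h S (aff (here refl)) ε 0<ε) (go Ss (aff ∘ there) ε 0<ε)

seq-pmf≤maxBias : ∀ {N} (g : Cube N → Bool) ν a i → seq (pmf ν a) i ≤ seq (maxBias g ν) i
seq-pmf≤maxBias g ν a i = ≤-trans (p≤∣p∣ (seq (pmf ν a) i)) (≤-trans (≤-reflexive (sym eq))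
  (seq-bias≤maxBias g ν (singleton a) (singleton-affine a) i))
  where
  ∣±p∣ : ∀ b → ∣ seq ([-1]^ b *ᴿ pmf ν a) i ∣ ≡ ∣ seq (pmf ν a) i ∣
  ∣±p∣ false = cong ∣_∣ (ℚ.*-identityˡ _)
  ∣±p∣ true  = trans (cong ∣_∣ (trans (sym (ℚ.neg-distribˡ-* 1ℚ (seq (pmf ν a) i))) (cong -_ (ℚ.*-identityˡ _))))
                     (ℚ.∣-p∣≡∣p∣ (seq (pmf ν a) i))
  eq : seq (bias g ν (singleton a)) i ≡ ∣ seq (pmf ν a) i ∣
  eq = trans (seq-bias g ν (singleton a) i)
    (trans (cong ∣_∣ (Σℚ-singleton a (λ x → seq ([-1]^ (g x) *ᴿ pmf ν x) i))) (∣±p∣ (g a)))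

Σℚ≤length : ∀ {A : Set} (xs : List A) {F : A → ℚ} {b} → (∀ x → F x ≤ b) → Σℚ xs F ≤ ι (List.length xs) * b
Σℚ≤length []       {b = b} h = ≤-reflexive (sym (ℚ.*-zeroˡ b))
Σℚ≤length (x ∷ xs) {b = b} h = ≤-trans (ℚ.+-mono-≤ (h x) (Σℚ≤length xs h)) (≤-reflexive (trans
  (solve 2 (λ b l → b :+ l :* b := (con 1ℚ :+ l) :* b) refl b (ι (List.length xs)))
  (cong (_* b) (sym (ι-+ 1 (List.length xs))))))

abstract

  maxBias-pos : ∀ {N} (g : Cube N → Bool) ν → 0ᴿ <ᴿ maxBias g ν
  maxBias-pos {N} g ν =
    let δ , 0<δ , eq = scale (ι (suc ℓ)) ½ (ι-pos ℓ) (*<* (ℤ.+<+ (ℕ.s≤s ℕ.z≤n)))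
        K , total = proj₂ (pmf-total ν) ½ (*<* (ℤ.+<+ (ℕ.s≤s ℕ.z≤n)))
    in δ , 0<δ , K , λ n n≥K → ≤-trans (≤-reflexive (ℚ.+-identityˡ δ))
         (ℚ.*-cancelˡ-≤-pos (ι (suc ℓ)) {{positive (ι-pos ℓ)}} (≤-trans (≤-reflexive eq) (bound n (total n n≥K))))
    where
    ℓ : ℕ
    ℓ = List.length (cube N)
    bound : ∀ n → 1ℚ ≤ seq (Σᴿ (cube N) (pmf ν)) n + ½ → ½ ≤ ι (suc ℓ) * seq (maxBias g ν) n
    bound n h = ≤-trans
      (≤-trans (ℚ.+-monoˡ-≤ (- ½) h) (≤-reflexive (solve 2 (λ s d → s :+ d :- d := s) refl (seq (Σᴿ (cube N) (pmf ν)) n) ½)))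
      (≤-trans (≤-reflexive (seq-Σᴿ (cube N) (pmf ν) n))
      (≤-trans (Σℚ≤length (cube N) (λ a → seq-pmf≤maxBias g ν a n))
      (ℚ.*-monoʳ-≤-nonNeg (seq (maxBias g ν) n) {{nonNegative 0≤max}} (ι-mono-≤ (ℕ.n≤1+n ℓ)))))
      where
      0≤max : 0ℚ ≤ seq (maxBias g ν) n
      0≤max = ≤-trans (ℚ.0≤∣p∣ _) (≤-trans (≤-reflexive (sym (seq-bias g ν (singleton 𝟎) n)))
        (seq-bias≤maxBias g ν (singleton 𝟎) (singleton-affine 𝟎) n))

disc : ∀ {N} → (Cube N → Bool) → Distribution N → ℝ
disc g ν = -ᴿ log₂ (maxBias g ν) (maxBias-pos g ν)

-- ({0,1}ⁿ)ᵏ is identified with {0,1}ᵏⁿ by concatenation.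

blocks : ∀ k {n} → Cube (k ℕ.* n) → Vec (Cube n) k
blocks k {n} x = proj₁ (Vec.group k n x)

infixl 8 _^⊕_ _^ᵖ_ _^ᴰ_

_^⊕_ : ∀ {n} → (Cube n → Bool) → ∀ k → Cube (k ℕ.* n) → Bool
(f ^⊕ k) x = Vec.foldr′ _xor_ false (Vec.map f (blocks k x))

_^ᵖ_ : ∀ {n} → (Cube n → ℝ) → ∀ k → Cube (k ℕ.* n) → ℝ
(p ^ᵖ k) x = Vec.foldr′ _*ᴿ_ 1ᴿ (Vec.map p (blocks k x))

Σℚ-product : ∀ n m (F : Cube n → ℚ) (G : Cube m → ℚ) →
  Σℚ (cube (n ℕ.+ m)) (λ x → F (proj₁ (Vec.splitAt n x)) * G (proj₁ (proj₂ (Vec.splitAt n x)))) ≡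
  Σℚ (cube n) F * Σℚ (cube m) G
Σℚ-product zero    m F G = trans (Σℚ-*ˡ (cube m) (F []) G) (cong (_* Σℚ (cube m) G) (sym (ℚ.+-identityʳ (F []))))
Σℚ-product (suc n) m F G = trans (Σℚ-cube (n ℕ.+ m) _) (trans
  (cong₂ _+_ (Σℚ-product n m (λ x → F (false ∷ x)) G) (Σℚ-product n m (λ x → F (true ∷ x)) G))
  (trans (sym (ℚ.*-distribʳ-+ (Σℚ (cube m) G) (Σℚ (cube n) (λ x → F (false ∷ x))) (Σℚ (cube n) (λ x → F (true ∷ x))))) (cong (_* Σℚ (cube m) G) (sym (Σℚ-cube n F)))))

abstract

  ^ᵖ-nonneg : ∀ {n} (p : Cube n → ℝ) → (∀ x → 0ᴿ ≤ᴿ p x) → ∀ k x → 0ᴿ ≤ᴿ (p ^ᵖ k) x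
  ^ᵖ-nonneg p h k x = go (blocks k x)
    where
    go : ∀ {k} (xs : Vec (Cube _) k) → 0ᴿ ≤ᴿ Vec.foldr′ _*ᴿ_ 1ᴿ (Vec.map p xs)
    go []       = ≤ᴿ-pointwise {0ᴿ} {1ᴿ} (λ _ → ℚ.<⇒≤ 0<1)
    go (x ∷ xs) = *ᴿ-nonneg {p x} {Vec.foldr′ _*ᴿ_ 1ᴿ (Vec.map p xs)} (h x) (go xs)

  ^ᵖ-total : ∀ {n} (p : Cube n → ℝ) → Σᴿ (cube n) p ≃ᴿ 1ᴿ → ∀ k → Σᴿ (cube (k ℕ.* n)) (p ^ᵖ k) ≃ᴿ 1ᴿ
  ^ᵖ-total     p h zero    = ≃ᴿ-pointwise {1ᴿ +ᴿ 0ᴿ} {1ᴿ} (λ _ → refl)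
  ^ᵖ-total {n} p h (suc k) = ≃ᴿ-trans {Σᴿ (cube (suc k ℕ.* n)) (p ^ᵖ suc k)} {s *ᴿ t} {1ᴿ}
    (≃ᴿ-pointwise {Σᴿ (cube (suc k ℕ.* n)) (p ^ᵖ suc k)} {s *ᴿ t} (λ i →
      trans (seq-Σᴿ (cube (suc k ℕ.* n)) (p ^ᵖ suc k) i)
      (trans (Σℚ-product n (k ℕ.* n) (λ x → seq (p x) i) (λ y → seq ((p ^ᵖ k) y) i))
      (sym (cong₂ _*_ (seq-Σᴿ (cube n) p i) (seq-Σᴿ (cube (k ℕ.* n)) (p ^ᵖ k) i))))))
    (≃ᴿ-trans {s *ᴿ t} {1ᴿ *ᴿ 1ᴿ} {1ᴿ} (*ᴿ-cong {s} {1ᴿ} {t} {1ᴿ} h (^ᵖ-total p h k))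
      (≃ᴿ-pointwise {1ᴿ *ᴿ 1ᴿ} {1ᴿ} (λ _ → refl)))
    where
    s t : ℝ
    s = Σᴿ (cube n) p
    t = Σᴿ (cube (k ℕ.* n)) (p ^ᵖ k)

_^ᴰ_ : ∀ {n} → Distribution n → ∀ k → Distribution (k ℕ.* n)
μ ^ᴰ k = record
  { pmf        = pmf μ ^ᵖ k
  ; pmf-nonneg = ^ᵖ-nonneg (pmf μ) (pmf-nonneg μ) k
  ; pmf-total  = ^ᵖ-total (pmf μ) (pmf-total μ) k
  }

{-# OPTIONS --safe #-}

-- Fix an index i of the approximating sequences and put φ x = (-1)^(f x) · μ(x)ᵢ.
-- The largest |∑_{x ∈ S} φ x| over affine S is at most the largest absolute value
-- of a Fourier coefficient φ̂ c, because imposing a linear constraint averages two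
-- Fourier coefficients, and |φ̂ c| is at most twice the maximal bias M, because
-- φ̂ c is a difference of sums over two parallel hyperplanes. Fourier coefficients
-- of a product multiply, whence M_k ≤ (2M)ᵏ for the maximal bias M_k of f^⊕k;
-- products of affine subspaces give Mᵏ ≤ M_k.

module Submission where

open import Defs
open import Algebra.Bundles using (CommutativeRing)
import Algebra.Properties.CommutativeSemiring.Exp as Exp
open import Data.Bool.Base using (Bool; true; false; if_then_else_; _xor_; _∧_; not; T)
open import Data.Bool.Properties
  using (T?; T-≡; ∧-zeroʳ; ∧-identityʳ; ∧-distribˡ-xor; ∧-distribʳ-xor;
         xor-assoc; xor-comm; xor-same; xor-identityʳ; not-distribˡ-xor; xor-annihilates-not)
open import Data.Empty using (⊥-elim)
import Data.Integer.Base as ℤ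
open import Data.List.Base as List using (List; []; _∷_; foldr)
open import Data.List.Membership.Propositional using (_∈_)
open import Data.List.Relation.Unary.Any using (here; there)
open import Data.Nat.Base using (ℕ; zero; suc; _≤_)
import Data.Nat.Base as ℕ
open import Data.Nat.Logarithm using (⌊log₂_⌋)
import Data.Nat.Properties as ℕ
open import Data.Product.Base using (∃-syntax; _×_; _,_)
open import Data.Rational.Base as ℚ
  using (ℚ; 0ℚ; 1ℚ; ½; _+_; _*_; _-_; -_; ∣_∣; ↥_; ↧ₙ_; nonNegative; positive)
open import Data.Rational.Properties as ℚ using (≤-refl; ≤-trans; ≤-reflexive)
open import Data.Rational.Solver using (module +-*-Solver)
open import Data.Sum.Base using (inj₁; inj₂)
open import Data.Unit.Base using (tt)
open import Data.Vec.Base as Vec using (Vec; []; _∷_; take; drop)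
open import Data.Vec.Properties
  using (take-zipWith; drop-zipWith; take++drop≡id; ++-injectiveˡ; ++-injectiveʳ; zipWith-identityʳ)
open import Function.Base using (_∘_)
open import Function.Bundles using (Equivalence)
open import Relation.Binary.PropositionalEquality
  using (_≡_; _≗_; refl; sym; trans; cong; cong₂; subst; subst₂; module ≡-Reasoning)
open import Relation.Nullary.Decidable using (yes; no)

open +-*-Solver using (solve; _:=_; _:+_; _:*_; _:-_; :-_; con)
open Exp (CommutativeRing.commutativeSemiring ℚ.+-*-commutativeRing)
  using (_^_) renaming (^-distrib-* to ^ℚ-distrib-*)

T-ext : ∀ {a b} → (T a → T b) → (T b → T a) → a ≡ b
T-ext {false} {false} _ _ = refl
T-ext {false} {true}  _ g = ⊥-elim (g tt)
T-ext {true}  {false} f _ = ⊥-elim (f tt)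
T-ext {true}  {true}  _ _ = refl

-- Linear algebra over 𝔽₂

⊕-cancelˡ : ∀ {N} (a x : Cube N) → a ⊕ (a ⊕ x) ≡ x
⊕-cancelˡ []      []      = refl
⊕-cancelˡ (a ∷ as) (x ∷ xs) =
  cong₂ _∷_ (trans (sym (xor-assoc a a x)) (cong (_xor x) (xor-same a))) (⊕-cancelˡ as xs)

⊕-cancelʳ : ∀ {N} (x a : Cube N) → (x ⊕ a) ⊕ a ≡ x
⊕-cancelʳ []       []       = refl
⊕-cancelʳ (x ∷ xs) (a ∷ as) =
  cong₂ _∷_ (trans (xor-assoc x a a) (trans (cong (x xor_) (xor-same a)) (xor-identityʳ x)))
            (⊕-cancelʳ xs as)

infix 7 _·_

_·_ : ∀ {N} → Cube N → Cube N → Bool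
[]       · []       = false
(c ∷ cs) · (x ∷ xs) = (c ∧ x) xor (cs · xs)

xor-interchange : ∀ a b c d → (a xor b) xor (c xor d) ≡ (a xor c) xor (b xor d)
xor-interchange false b c d =
  trans (sym (xor-assoc b c d)) (trans (cong (_xor d) (xor-comm b c)) (xor-assoc c b d))
xor-interchange true b false d = sym (not-distribˡ-xor b d)
xor-interchange true b true  d = xor-annihilates-not b d

·-distribˡ-⊕ : ∀ {N} (c x y : Cube N) → c · (x ⊕ y) ≡ (c · x) xor (c · y)
·-distribˡ-⊕ []       []       []       = refl
·-distribˡ-⊕ (c ∷ cs) (x ∷ xs) (y ∷ ys) = trans
  (cong₂ _xor_ (∧-distribˡ-xor c x y) (·-distribˡ-⊕ cs xs ys))
  (xor-interchange (c ∧ x) (c ∧ y) (cs · xs) (cs · ys))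

·-distribʳ-⊕ : ∀ {N} (x c d : Cube N) → (c ⊕ d) · x ≡ (c · x) xor (d · x)
·-distribʳ-⊕ []       []       []       = refl
·-distribʳ-⊕ (x ∷ xs) (c ∷ cs) (d ∷ ds) = trans
  (cong₂ _xor_ (∧-distribʳ-xor x c d) (·-distribʳ-⊕ xs cs ds))
  (xor-interchange (c ∧ x) (d ∧ x) (cs · xs) (ds · xs))

·-zeroˡ : ∀ {N} (x : Cube N) → 𝟎 · x ≡ false
·-zeroˡ []       = refl
·-zeroˡ (x ∷ xs) = ·-zeroˡ xs

·-split : ∀ n {m} (c x : Cube (n ℕ.+ m)) →
  c · x ≡ (take n c · take n x) xor (drop n c · drop n x)
·-split zero    c        x        = refl
·-split (suc n) (c ∷ cs) (x ∷ xs) = trans (cong ((c ∧ x) xor_) (·-split n cs xs))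
  (sym (xor-assoc (c ∧ x) (take n cs · take n xs) (drop n cs · drop n xs)))

-- A subspace is held as a list of linear constraints, so that sums over it can be bounded by
-- imposing one constraint at a time.
annihilated : ∀ {N} → List (Cube N) → Cube N → Bool
annihilated []       x = true
annihilated (c ∷ cs) x = not (c · x) ∧ annihilated cs x

-- Prefixing `c · w` is the one way to extend the functional `c` so that it vanishes on (1,w). Hence
-- the extended constraints cut out the span of (1,w) and the vectors (0,x) with `x` annihilated by
-- `cs`; this lemma and the next treat the two values of the first coordinate.
annihilated-graph₀ : ∀ {N} (w : Cube N) cs x →
  annihilated (List.map (λ c → (c · w) ∷ c) cs) (false ∷ x) ≡ annihilated cs x
annihilated-graph₀ w []       x = refl
annihilated-graph₀ w (c ∷ cs) x = cong₂ _∧_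
  (cong (λ b → not (b xor (c · x))) (∧-zeroʳ (c · w))) (annihilated-graph₀ w cs x)

annihilated-graph₁ : ∀ {N} (w : Cube N) cs x →
  annihilated (List.map (λ c → (c · w) ∷ c) cs) (true ∷ x) ≡ annihilated cs (x ⊕ w)
annihilated-graph₁ w []       x = refl
annihilated-graph₁ w (c ∷ cs) x = cong₂ _∧_
  (cong not (trans (cong (_xor (c · x)) (∧-identityʳ (c · w)))
    (trans (xor-comm (c · w) (c · x)) (sym (·-distribˡ-⊕ c x w)))))
  (annihilated-graph₁ w cs x)

annihilated-false∷ : ∀ {N} cs b (x : Cube N) →
  annihilated (List.map (false ∷_) cs) (b ∷ x) ≡ annihilated cs x
annihilated-false∷ []       b x = refl
annihilated-false∷ (c ∷ cs) b x = cong (not (c · x) ∧_) (annihilated-false∷ cs b x)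

-- A linear subspace V of 𝔽₂ᴺ⁺¹ is determined by V₀ = { x ∣ (0,x) ∈ V } and, if
-- there is one, an element (1,w): then (1,x) ∈ V iff x + w ∈ V₀.
linear⇒annihilated : ∀ {N} (V : Cube N → Bool) → IsLinear V → ∃[ cs ] V ≗ annihilated cs
linear⇒annihilated {zero}  V (V𝟎 , _) = [] , λ { [] → Equivalence.to T-≡ V𝟎 }
linear⇒annihilated {suc N} V (V𝟎 , V⊕)
  with linear⇒annihilated (V ∘ (false ∷_)) (V𝟎 , λ x y → V⊕ (false ∷ x) (false ∷ y))
     | any? (λ w → T? (V (true ∷ w)))
... | cs , V₀≗ | yes (w , Vw) = List.map (λ c → (c · w) ∷ c) cs , λ where
  (false ∷ x) → trans (V₀≗ x) (sym (annihilated-graph₀ w cs x))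
  (true  ∷ x) → trans
    (T-ext (λ Vx → V⊕ (true ∷ x) (true ∷ w) Vx Vw)
           (λ Vx+w → subst (λ z → T (V (true ∷ z))) (⊕-cancelʳ x w)
                       (V⊕ (false ∷ (x ⊕ w)) (true ∷ w) Vx+w Vw)))
    (trans (V₀≗ (x ⊕ w)) (sym (annihilated-graph₁ w cs x)))
-- The functional `true ∷ 𝟎` reads off the first coordinate and forces it to be 0.
... | cs , V₀≗ | no ∄w = (true ∷ 𝟎) ∷ List.map (false ∷_) cs , λ where
  (false ∷ x) → trans (V₀≗ x) (sym (cong₂ _∧_ (cong not (·-zeroˡ x)) (annihilated-false∷ cs false x)))
  (true  ∷ x) → trans (T-ext (λ Vx → ∄w (x , Vx)) (λ ()))
    (sym (cong (λ b → not (not b) ∧ annihilated (List.map (false ∷_) cs) (true ∷ x)) (·-zeroˡ x)))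

-- The offset is complemented: `b = true` gives the solutions of c · x = 0 and `b = false` those of
-- c · x = 1. For `c = 𝟎` these are the whole space and the empty set.
hyperplane : ∀ {N} → Cube N → Bool → Cube N → Bool
hyperplane c b x = b xor (c · x)

-- Translation by a solution `a` makes the equation homogeneous. A solution has to be supplied
-- because the empty set is not affine.
hyperplane-affine : ∀ {N} (c : Cube N) b a → T (hyperplane c b a) → IsAffine (hyperplane c b)
hyperplane-affine c b a a∈ =
  a , subst (T ∘ hyperplane c b) (sym (zipWith-identityʳ xor-identityʳ a)) a∈ ,
  λ x y x∈ y∈ → subst T (sym (trans (shifted (x ⊕ y)) (cong not (·-distribˡ-⊕ c x y))))
    (closed (c · x) (c · y) (subst T (shifted x) x∈) (subst T (shifted y) y∈))
  where
  shifted : ∀ v → hyperplane c b (a ⊕ v) ≡ not (c · v)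
  shifted v = trans (cong (b xor_) (·-distribˡ-⊕ c a v)) (trans (sym (xor-assoc b (c · a) (c · v)))
    (cong (_xor (c · v)) (Equivalence.to T-≡ a∈)))
  closed : ∀ p q → T (not p) → T (not q) → T (not (p xor q))
  closed false false _ _ = tt

-- Products of affine subspaces

take-++ : ∀ {A : Set} n {m} (x : Vec A n) (y : Vec A m) → take n (x Vec.++ y) ≡ x
take-++ n x y = ++-injectiveˡ (take n (x Vec.++ y)) x (take++drop≡id n (x Vec.++ y))

drop-++ : ∀ {A : Set} n {m} (x : Vec A n) (y : Vec A m) → drop n (x Vec.++ y) ≡ y
drop-++ n x y = ++-injectiveʳ (take n (x Vec.++ y)) x (take++drop≡id n (x Vec.++ y))

infixr 7 _⊠_ _⊗_

_⊠_ : ∀ {n m} → (Cube n → Bool) → (Cube m → Bool) → Cube (n ℕ.+ m) → Bool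
_⊠_ {n} S S′ z = S (take n z) ∧ S′ (drop n z)

-- Relative to the concatenated base point, membership splits by `shifted` into one condition on
-- each half, and addition acts on the halves separately.
⊠-affine : ∀ {n m} {S : Cube n → Bool} {S′ : Cube m → Bool} → IsAffine S → IsAffine S′ → IsAffine (S ⊠ S′)
⊠-affine {n} {m} {S} {S′} (a , S𝟎 , S⊕) (a′ , S′𝟎 , S′⊕) =
  a Vec.++ a′ ,
  intro 𝟎 (subst (λ z → T (S (a ⊕ z))) (sym (take-𝟎 n)) S𝟎)
          (subst (λ z → T (S′ (a′ ⊕ z))) (sym (drop-𝟎 n)) S′𝟎) ,
  λ x y x∈ y∈ →
    let x₁ , x₂ = elim x x∈
        y₁ , y₂ = elim y y∈
    in intro (x ⊕ y)
         (subst (λ z → T (S (a ⊕ z))) (sym (take-zipWith _xor_ x y)) (S⊕ (take n x) (take n y) x₁ y₁))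
         (subst (λ z → T (S′ (a′ ⊕ z))) (sym (drop-zipWith {m = n} _xor_ x y)) (S′⊕ (drop n x) (drop n y) x₂ y₂))
  where
  take-𝟎 : ∀ n {m} → take n {m} 𝟎 ≡ 𝟎
  take-𝟎 zero    = refl
  take-𝟎 (suc n) = cong (false ∷_) (take-𝟎 n)
  drop-𝟎 : ∀ n {m} → drop n {m} 𝟎 ≡ 𝟎
  drop-𝟎 zero    = refl
  drop-𝟎 (suc n) = drop-𝟎 n
  shifted : ∀ v → (S ⊠ S′) ((a Vec.++ a′) ⊕ v) ≡ S (a ⊕ take n v) ∧ S′ (a′ ⊕ drop n v)
  shifted v = cong₂ _∧_
    (cong S (trans (take-zipWith _xor_ (a Vec.++ a′) v) (cong (_⊕ take n v) (take-++ n a a′))))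
    (cong S′ (trans (drop-zipWith {m = n} _xor_ (a Vec.++ a′) v) (cong (_⊕ drop n v) (drop-++ n a a′))))
  T-∧-intro : ∀ {p q} → T p → T q → T (p ∧ q)
  T-∧-intro {true} {true} _ _ = tt
  T-∧-elim : ∀ {p q} → T (p ∧ q) → T p × T q
  T-∧-elim {true} {true} _ = tt , tt
  intro : ∀ v → T (S (a ⊕ take n v)) → T (S′ (a′ ⊕ drop n v)) → T ((S ⊠ S′) ((a Vec.++ a′) ⊕ v))
  intro v p q = subst T (sym (shifted v)) (T-∧-intro p q)
  elim : ∀ v → T ((S ⊠ S′) ((a Vec.++ a′) ⊕ v)) → T (S (a ⊕ take n v)) × T (S′ (a′ ⊕ drop n v))
  elim v p = T-∧-elim (subst T (shifted v) p)

-- Fourier coefficients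

sign : Bool → ℚ
sign false = 1ℚ
sign true  = - 1ℚ

sign-xor : ∀ a b → sign (a xor b) ≡ sign a * sign b
sign-xor false false = refl
sign-xor false true  = refl
sign-xor true  false = refl
sign-xor true  true  = refl

∣sign*p∣≡∣p∣ : ∀ b p → ∣ sign b * p ∣ ≡ ∣ p ∣
∣sign*p∣≡∣p∣ false p = cong ∣_∣ (ℚ.*-identityˡ p)
∣sign*p∣≡∣p∣ true  p = trans (cong ∣_∣ (solve 1 (λ p → :- con 1ℚ :* p := :- p) refl p)) (ℚ.∣-p∣≡∣p∣ p)

infixl 6 _↾_

-- Restriction is extended by zero, so that the result is again a function on the whole cube and has
-- Fourier coefficients.
_↾_ : ∀ {N} → (Cube N → ℚ) → (Cube N → Bool) → Cube N → ℚ
(φ ↾ S) x = if S x then φ x else 0ℚ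

_⊗_ : ∀ {n m} → (Cube n → ℚ) → (Cube m → ℚ) → Cube (n ℕ.+ m) → ℚ
_⊗_ {n} φ ψ z = φ (take n z) * ψ (drop n z)

∑ : ∀ {N} → (Cube N → ℚ) → ℚ
∑ {N} = Σℚ (cube N)

∑-cong : ∀ {N} {φ ψ : Cube N → ℚ} → φ ≗ ψ → ∑ φ ≡ ∑ ψ
∑-cong {N} = Σℚ-cong (cube N)

Σℚ-distrib-+ : ∀ {A : Set} (xs : List A) (F G : A → ℚ) → Σℚ xs (λ x → F x + G x) ≡ Σℚ xs F + Σℚ xs G
Σℚ-distrib-+ []       F G = refl
Σℚ-distrib-+ (x ∷ xs) F G = trans (cong (F x + G x +_) (Σℚ-distrib-+ xs F G))
  (solve 4 (λ a b c d → (a :+ b) :+ (c :+ d) := (a :+ c) :+ (b :+ d)) refl (F x) (G x) (Σℚ xs F) (Σℚ xs G))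

-- The Walsh-Hadamard transform without normalising factor; thus the coefficient at `𝟎` is the full
-- sum, and coefficients of products multiply exactly.
fourier : ∀ {N} → (Cube N → ℚ) → Cube N → ℚ
fourier φ c = ∑ (λ x → sign (c · x) * φ x)

-- A character of the concatenated cube is the product of a character of each half, so the sum
-- factors.
fourier-⊗ : ∀ {n m} (φ : Cube n → ℚ) (ψ : Cube m → ℚ) c →
  fourier (φ ⊗ ψ) c ≡ fourier φ (take n c) * fourier ψ (drop n c)
fourier-⊗ {n} {m} φ ψ c = trans
  (∑-cong λ z → trans
    (cong (_* (φ ⊗ ψ) z) (trans (cong sign (·-split n c z))
      (sign-xor (take n c · take n z) (drop n c · drop n z))))
    (solve 4 (λ s t a b → s :* t :* (a :* b) := s :* a :* (t :* b)) refl
      (sign (take n c · take n z)) (sign (drop n c · drop n z)) (φ (take n z)) (ψ (drop n z))))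
  (Σℚ-product n m (λ x → sign (take n c · x) * φ x) (λ y → sign (drop n c · y) * ψ y))

∑-⊗-↾ : ∀ {n m} (φ : Cube n → ℚ) (ψ : Cube m → ℚ) S S′ →
  ∑ (φ ⊗ ψ ↾ (S ⊠ S′)) ≡ ∑ (φ ↾ S) * ∑ (ψ ↾ S′)
∑-⊗-↾ {n} {m} φ ψ S S′ = trans
  (∑-cong λ z → if-∧-* (S (take n z)) (S′ (drop n z)) (φ (take n z)) (ψ (drop n z)))
  (Σℚ-product n m (φ ↾ S) (ψ ↾ S′))
  where
  if-∧-* : ∀ b b′ p q → (if b ∧ b′ then p * q else 0ℚ) ≡ (if b then p else 0ℚ) * (if b′ then q else 0ℚ)
  if-∧-* false b′    p q = sym (ℚ.*-zeroˡ (if b′ then q else 0ℚ))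
  if-∧-* true  false p q = sym (ℚ.*-zeroʳ p)
  if-∧-* true  true  p q = refl

-- The indicator of c · x = c · a is ½ (1 + (-1)^(c·a) (-1)^(c·x)).
fourier-constraint : ∀ {N} (φ : Cube N → ℚ) c a d →
  fourier (φ ↾ (λ x → not (c · (a ⊕ x)))) d ≡ ½ * fourier φ d + ½ * (sign (c · a) * fourier φ (d ⊕ c))
fourier-constraint {N} φ c a d = begin
  fourier (φ ↾ (λ x → not (c · (a ⊕ x)))) d
    ≡⟨ ∑-cong pointwise ⟩
  ∑ (λ x → ½ * F x + ½ * (s * G x))
    ≡⟨ Σℚ-distrib-+ (cube N) (λ x → ½ * F x) (λ x → ½ * (s * G x)) ⟩
  ∑ (λ x → ½ * F x) + ∑ (λ x → ½ * (s * G x))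
    ≡⟨ cong₂ _+_ (Σℚ-*ˡ (cube N) ½ F) (trans (Σℚ-*ˡ (cube N) ½ (λ x → s * G x)) (cong (½ *_) (Σℚ-*ˡ (cube N) s G))) ⟩
  ½ * fourier φ d + ½ * (s * fourier φ (d ⊕ c)) ∎
  where
  open ≡-Reasoning
  s : ℚ
  s = sign (c · a)
  F G : Cube N → ℚ
  F x = sign (d · x) * φ x
  G x = sign ((d ⊕ c) · x) * φ x
  indicator : ∀ b p → (if not b then p else 0ℚ) ≡ ½ * (p + sign b * p)
  indicator false p = solve 1 (λ p → p := con ½ :* (p :+ con 1ℚ :* p)) refl p
  indicator true  p = solve 1 (λ p → con 0ℚ := con ½ :* (p :+ :- con 1ℚ :* p)) refl p
  pointwise : ∀ x → sign (d · x) * (if not (c · (a ⊕ x)) then φ x else 0ℚ) ≡ ½ * F x + ½ * (s * G x)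
  pointwise x = begin
    sign (d · x) * (if not (c · (a ⊕ x)) then φ x else 0ℚ)
      ≡⟨ cong (sign (d · x) *_) (trans (indicator (c · (a ⊕ x)) (φ x))
           (cong (λ t → ½ * (φ x + t * φ x)) (trans (cong sign (·-distribˡ-⊕ c a x)) (sign-xor (c · a) (c · x))))) ⟩
    sign (d · x) * (½ * (φ x + s * sign (c · x) * φ x))
      ≡⟨ solve 5 (λ h t s r p → t :* (h :* (p :+ s :* r :* p)) := h :* (t :* p) :+ h :* (s :* (t :* r :* p)))
           refl ½ (sign (d · x)) s (sign (c · x)) (φ x) ⟩
    ½ * F x + ½ * (s * (sign (d · x) * sign (c · x) * φ x))
      ≡⟨ cong (λ t → ½ * F x + ½ * (s * (t * φ x)))
           (sym (trans (cong sign (·-distribʳ-⊕ x d c)) (sign-xor (d · x) (c · x)))) ⟩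
    ½ * F x + ½ * (s * G x) ∎

-- Sums over affine subspaces versus Fourier coefficients

∣½p+½q∣≤ : ∀ p q {B} → ∣ p ∣ ℚ.≤ B → ∣ q ∣ ℚ.≤ B → ∣ ½ * p + ½ * q ∣ ℚ.≤ B
∣½p+½q∣≤ p q {B} p≤B q≤B = ≤-trans (ℚ.∣p+q∣≤∣p∣+∣q∣ (½ * p) (½ * q)) (≤-trans
  (ℚ.+-mono-≤ (half p p≤B) (half q q≤B))
  (≤-reflexive (solve 1 (λ B → con ½ :* B :+ con ½ :* B := B) refl B)))
  where
  half : ∀ p → ∣ p ∣ ℚ.≤ B → ∣ ½ * p ∣ ℚ.≤ ½ * B
  half p p≤B = ≤-trans (≤-reflexive (ℚ.∣p*q∣≡∣p∣*∣q∣ ½ p)) (ℚ.*-monoˡ-≤-nonNeg ½ p≤B)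

-- Induction on the constraints with `φ` varying: the first constraint is absorbed into `φ`. Up to
-- sign, each coefficient of the restricted function is an average of two coefficients of `φ`, so
-- the same `B` still bounds them all. Once no constraint is left, the sum is the coefficient at
-- `𝟎`.
∑-annihilated≤ : ∀ {N} cs a (φ : Cube N → ℚ) {B} → (∀ c → ∣ fourier φ c ∣ ℚ.≤ B) →
  ∣ ∑ (φ ↾ (λ x → annihilated cs (a ⊕ x))) ∣ ℚ.≤ B
∑-annihilated≤ [] a φ h = ≤-trans
  (≤-reflexive (cong ∣_∣ (∑-cong λ x → sym (trans (cong (λ b → sign b * φ x) (·-zeroˡ x)) (ℚ.*-identityˡ (φ x))))))
  (h 𝟎)
∑-annihilated≤ (c ∷ cs) a φ {B} h = ≤-trans
  (≤-reflexive (cong ∣_∣ (∑-cong λ x → if-∧ (not (c · (a ⊕ x))) (annihilated cs (a ⊕ x)) (φ x))))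
  (∑-annihilated≤ cs a (φ ↾ (λ x → not (c · (a ⊕ x)))) λ d → ≤-trans
    (≤-reflexive (cong ∣_∣ (fourier-constraint φ c a d)))
    (∣½p+½q∣≤ (fourier φ d) (sign (c · a) * fourier φ (d ⊕ c)) (h d)
      (≤-trans (≤-reflexive (∣sign*p∣≡∣p∣ (c · a) (fourier φ (d ⊕ c)))) (h (d ⊕ c)))))
  where
  if-∧ : ∀ b b′ p → (if b ∧ b′ then p else 0ℚ) ≡ (if b′ then (if b then p else 0ℚ) else 0ℚ)
  if-∧ false false p = refl
  if-∧ false true  p = refl
  if-∧ true  b′    p = refl

∑-affine≤ : ∀ {N} (φ : Cube N → ℚ) {B} → (∀ c → ∣ fourier φ c ∣ ℚ.≤ B) →
  ∀ S → IsAffine S → ∣ ∑ (φ ↾ S) ∣ ℚ.≤ B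
∑-affine≤ φ h S (a , lin) with linear⇒annihilated (λ v → S (a ⊕ v)) lin
... | cs , S≗ = ≤-trans
  (≤-reflexive (cong ∣_∣ (∑-cong λ x → cong (λ b → if b then φ x else 0ℚ)
    (trans (cong S (sym (⊕-cancelˡ a x))) (S≗ (a ⊕ x))))))
  (∑-annihilated≤ cs a φ h)

-- The character of `c` is +1 on `hyperplane c true` and -1 on `hyperplane c false`. Each side
-- contributes at most `M`, whence the factor 2.
fourier≤ : ∀ {N} (φ : Cube N → ℚ) {M} → (∀ S → IsAffine S → ∣ ∑ (φ ↾ S) ∣ ℚ.≤ M) →
  ∀ c → ∣ fourier φ c ∣ ℚ.≤ ι 2 * M
fourier≤ {N} φ {M} h c = ≤-trans
  (≤-reflexive (cong ∣_∣ (trans (∑-cong λ x → pointwise (c · x) (φ x))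
    (Σℚ-distrib-+ (cube N) (φ ↾ hyperplane c true) (λ x → - 1ℚ * (φ ↾ hyperplane c false) x)))))
  (≤-trans (ℚ.∣p+q∣≤∣p∣+∣q∣ (∑ (φ ↾ hyperplane c true)) _)
  (≤-trans (ℚ.+-mono-≤ (side true) (≤-trans (≤-reflexive (trans
      (cong ∣_∣ (Σℚ-*ˡ (cube N) (- 1ℚ) (φ ↾ hyperplane c false)))
      (∣sign*p∣≡∣p∣ true (∑ (φ ↾ hyperplane c false))))) (side false)))
    (≤-reflexive (solve 1 (λ M → M :+ M := con (ι 2) :* M) refl M))))
  where
  pointwise : ∀ b p → sign b * p ≡ (if not b then p else 0ℚ) + - 1ℚ * (if b then p else 0ℚ)
  pointwise false p = solve 1 (λ p → con 1ℚ :* p := p :+ :- con 1ℚ :* con 0ℚ) refl p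
  pointwise true  p = solve 1 (λ p → :- con 1ℚ :* p := con 0ℚ :+ :- con 1ℚ :* p) refl p
  side : ∀ b → ∣ ∑ (φ ↾ hyperplane c b) ∣ ℚ.≤ M
  side b with any? (λ x → T? (hyperplane c b x))
  ... | yes (a , a∈) = h (hyperplane c b) (hyperplane-affine c b a a∈)
  -- An empty side contributes 0, and 0 ≤ `M` follows from the hypothesis on any affine set, here a
  -- singleton.
  ... | no  ∄a       = ≤-trans
    (≤-reflexive (cong ∣_∣ (trans (∑-cong λ x → vanish (hyperplane c b x) (λ x∈ → ∄a (x , x∈)) (φ x)) (Σℚ-zero (cube N)))))
    (≤-trans (ℚ.0≤∣p∣ (∑ (φ ↾ singleton 𝟎))) (h (singleton 𝟎) (singleton-affine 𝟎)))
    where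
    vanish : ∀ b → (T b → T false) → ∀ p → (if b then p else 0ℚ) ≡ 0ℚ
    vanish false _ p = refl
    vanish true  b⇒⊥ p = ⊥-elim (b⇒⊥ tt)

-- Maximal bias of the k-fold sum

signed : ∀ {N} → (Cube N → Bool) → Distribution N → ℕ → Cube N → ℚ
signed g ν i x = seq ([-1]^ (g x) *ᴿ pmf ν x) i

-- At a fixed index the maximum is taken over finitely many rationals, so a maximiser can be
-- selected by comparing them. It may change with `i`, which is harmless because the bounds below
-- are proved index by index.
maxBias-attained : ∀ {N} (g : Cube N → Bool) ν i →
  ∃[ S ] IsAffine S × seq (maxBias g ν) i ℚ.≤ ∣ ∑ (signed g ν i ↾ S) ∣
maxBias-attained {N} g ν i = go (affineSubspaces N) affineSubspaces-sound
  where
  go : ∀ Ss → (∀ {S} → S ∈ Ss → IsAffine S) →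
    ∃[ S ] IsAffine S × seq (foldr _⊔ᴿ_ 0ᴿ (List.map (bias g ν) Ss)) i ℚ.≤ ∣ ∑ (signed g ν i ↾ S) ∣
  -- The initial value 0 of the fold lies below the absolute sum over any affine set.
  go [] _ = singleton 𝟎 , singleton-affine 𝟎 , ℚ.0≤∣p∣ (∑ (signed g ν i ↾ singleton 𝟎))
  go (S ∷ Ss) aff with ℚ.⊔-sel (seq (bias g ν S) i) (seq (foldr _⊔ᴿ_ 0ᴿ (List.map (bias g ν) Ss)) i)
  ... | inj₁ eq = S , aff (here refl) , ≤-reflexive (trans eq (seq-bias g ν S i))
  ... | inj₂ eq = let S′ , aff′ , ≤S′ = go Ss (aff ∘ there) in S′ , aff′ , ≤-trans (≤-reflexive eq) ≤S′

∑-signed≤maxBias : ∀ {N} (g : Cube N → Bool) ν i S → IsAffine S →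
  ∣ ∑ (signed g ν i ↾ S) ∣ ℚ.≤ seq (maxBias g ν) i
∑-signed≤maxBias g ν i S aff = ≤-trans (≤-reflexive (sym (seq-bias g ν S i))) (seq-bias≤maxBias g ν S aff i)

0≤maxBias : ∀ {N} (g : Cube N → Bool) ν i → 0ℚ ℚ.≤ seq (maxBias g ν) i
0≤maxBias g ν i = ≤-trans (ℚ.0≤∣p∣ (∑ (signed g ν i ↾ singleton 𝟎)))
  (∑-signed≤maxBias g ν i (singleton 𝟎) (singleton-affine 𝟎))

module _ {n} (f : Cube n → Bool) (μ : Distribution n) (i : ℕ) where

  -- Signs turn exclusive or into multiplication, and the product distribution is a product over
  -- blocks. Splitting off the first block is definitional, so only the order of four factors has to
  -- change.
  signed-suc : ∀ k → signed (f ^⊕ suc k) (μ ^ᴰ suc k) i ≗ signed f μ i ⊗ signed (f ^⊕ k) (μ ^ᴰ k) i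
  signed-suc k z = trans
    (cong (_* (seq (pmf μ x) i * q)) ([-1]^-xor (f x) ((f ^⊕ k) y)))
    (solve 4 (λ s t p q → s :* t :* (p :* q) := s :* p :* (t :* q)) refl
      (seq ([-1]^ (f x)) i) (seq ([-1]^ ((f ^⊕ k) y)) i) (seq (pmf μ x) i) q)
    where
    x : Cube n
    x = take n z
    y : Cube (k ℕ.* n)
    y = drop n z
    q : ℚ
    q = seq (pmf (μ ^ᴰ k) y) i
    [-1]^-xor : ∀ a b → seq ([-1]^ (a xor b)) i ≡ seq ([-1]^ a) i * seq ([-1]^ b) i
    [-1]^-xor false false = refl
    [-1]^-xor false true  = refl
    [-1]^-xor true  false = refl
    [-1]^-xor true  true  = refl

  -- A maximiser for one block times a maximiser for `k` blocks is an affine set competing in the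
  -- maximum for `suc k` blocks, and the sum over it factors.
  maxBias^k≤ : ∀ k → seq (maxBias f μ) i ^ k ℚ.≤ seq (maxBias (f ^⊕ k) (μ ^ᴰ k)) i
  -- The cube of dimension 0 is a single point of signed mass 1, which is the empty power.
  maxBias^k≤ zero    = ∑-signed≤maxBias (f ^⊕ 0) (μ ^ᴰ 0) i (singleton 𝟎) (singleton-affine 𝟎)
  maxBias^k≤ (suc k) =
    let S  , aff  , M≤  = maxBias-attained f μ i
        S′ , aff′ , Mₖ≤ = maxBias-attained (f ^⊕ k) (μ ^ᴰ k) i
        φ = signed f μ i
        ψ = signed (f ^⊕ k) (μ ^ᴰ k) i
    in begin
      seq (maxBias f μ) i * seq (maxBias f μ) i ^ k
        ≤⟨ ℚ.*-monoˡ-≤-nonNeg (seq (maxBias f μ) i) {{nonNegative (0≤maxBias f μ i)}} (maxBias^k≤ k) ⟩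
      seq (maxBias f μ) i * seq (maxBias (f ^⊕ k) (μ ^ᴰ k)) i
        ≤⟨ *-mono-≤ (0≤maxBias (f ^⊕ k) (μ ^ᴰ k) i) (ℚ.0≤∣p∣ (∑ (φ ↾ S))) M≤ Mₖ≤ ⟩
      ∣ ∑ (φ ↾ S) ∣ * ∣ ∑ (ψ ↾ S′) ∣
        ≡⟨ ℚ.∣p*q∣≡∣p∣*∣q∣ (∑ (φ ↾ S)) (∑ (ψ ↾ S′)) ⟨
      ∣ ∑ (φ ↾ S) * ∑ (ψ ↾ S′) ∣
        ≡⟨ cong ∣_∣ (∑-⊗-↾ φ ψ S S′) ⟨
      ∣ ∑ (φ ⊗ ψ ↾ (S ⊠ S′)) ∣
        ≡⟨ cong ∣_∣ (∑-cong λ z → cong (λ p → if (S ⊠ S′) z then p else 0ℚ) (signed-suc k z)) ⟨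
      ∣ ∑ (signed (f ^⊕ suc k) (μ ^ᴰ suc k) i ↾ (S ⊠ S′)) ∣
        ≤⟨ ∑-signed≤maxBias (f ^⊕ suc k) (μ ^ᴰ suc k) i (S ⊠ S′) (⊠-affine {S = S} {S′} aff aff′) ⟩
      seq (maxBias (f ^⊕ suc k) (μ ^ᴰ suc k)) i ∎
    where open ℚ.≤-Reasoning

  fourier-signed≤ : ∀ k c → ∣ fourier (signed (f ^⊕ k) (μ ^ᴰ k) i) c ∣ ℚ.≤ (ι 2 * seq (maxBias f μ) i) ^ k
  -- With no blocks there is a single coefficient, equal to 1.
  fourier-signed≤ zero    [] = ≤-refl
  fourier-signed≤ (suc k) c  = begin
    ∣ fourier (signed (f ^⊕ suc k) (μ ^ᴰ suc k) i) c ∣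
      ≡⟨ cong ∣_∣ (trans (∑-cong λ z → cong (sign (c · z) *_) (signed-suc k z)) (fourier-⊗ φ ψ c)) ⟩
    ∣ fourier φ (take n c) * fourier ψ (drop n c) ∣
      ≡⟨ ℚ.∣p*q∣≡∣p∣*∣q∣ (fourier φ (take n c)) (fourier ψ (drop n c)) ⟩
    ∣ fourier φ (take n c) ∣ * ∣ fourier ψ (drop n c) ∣
      ≤⟨ *-mono-≤ (ℚ.0≤∣p∣ (fourier ψ (drop n c))) (≤-trans (ℚ.0≤∣p∣ (fourier φ (take n c))) φ≤) φ≤ (fourier-signed≤ k (drop n c)) ⟩
    (ι 2 * seq (maxBias f μ) i) ^ suc k ∎
    where
    open ℚ.≤-Reasoning
    φ : Cube n → ℚ
    φ = signed f μ i
    ψ : Cube (k ℕ.* n) → ℚ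
    ψ = signed (f ^⊕ k) (μ ^ᴰ k) i
    φ≤ : ∣ fourier φ (take n c) ∣ ℚ.≤ ι 2 * seq (maxBias f μ) i
    φ≤ = fourier≤ φ (∑-signed≤maxBias f μ i) (take n c)

  maxBias≤[2*]^k : ∀ k → seq (maxBias (f ^⊕ k) (μ ^ᴰ k)) i ℚ.≤ (ι 2 * seq (maxBias f μ) i) ^ k
  maxBias≤[2*]^k k = let S , aff , ≤S = maxBias-attained (f ^⊕ k) (μ ^ᴰ k) i in
    ≤-trans ≤S (∑-affine≤ (signed (f ^⊕ k) (μ ^ᴰ k) i) (fourier-signed≤ k) S aff)

-- Logarithms

^-^-comm : ∀ a m n → (a ℕ.^ m) ℕ.^ n ≡ (a ℕ.^ n) ℕ.^ m
^-^-comm a m n = trans (ℕ.^-*-assoc a m n) (trans (cong (a ℕ.^_) (ℕ.*-comm m n)) (sym (ℕ.^-*-assoc a n m)))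

-- The hypothesis is A / D ≤ 2^c (C / B)^k with denominators cleared. After raising it to the power
-- `m`, the left side is rounded down and the right side up to powers of 2, and the exponents are
-- compared. The total rounding error is k + 1 for every `m`, so it becomes negligible on division
-- by `m`.
log-power-compare : ∀ k c m A B C D → .{{ℕ.NonZero A}} → .{{ℕ.NonZero B}} →
  A ℕ.* B ℕ.^ k ≤ 2 ℕ.^ c ℕ.* (C ℕ.^ k ℕ.* D) →
  ⌊log₂ A ℕ.^ m ⌋ ℕ.+ ⌊log₂ B ℕ.^ m ⌋ ℕ.* k ≤
  c ℕ.* m ℕ.+ (suc ⌊log₂ C ℕ.^ m ⌋ ℕ.* k ℕ.+ suc ⌊log₂ D ℕ.^ m ⌋)
log-power-compare k c m A B C D h = 2^-cancel-≤ _ _ (begin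
  2 ℕ.^ (α ℕ.+ β ℕ.* k)
    ≡⟨ trans (ℕ.^-distribˡ-+-* 2 α (β ℕ.* k)) (cong (2 ℕ.^ α ℕ.*_) (sym (ℕ.^-*-assoc 2 β k))) ⟩
  2 ℕ.^ α ℕ.* (2 ℕ.^ β) ℕ.^ k
    ≤⟨ ℕ.*-mono-≤ (2^⌊log₂n⌋≤n (A ℕ.^ m) {{ℕ.m^n≢0 A m}})
                  (ℕ.^-monoˡ-≤ k (2^⌊log₂n⌋≤n (B ℕ.^ m) {{ℕ.m^n≢0 B m}})) ⟩
  A ℕ.^ m ℕ.* (B ℕ.^ m) ℕ.^ k
    ≡⟨ trans (cong (A ℕ.^ m ℕ.*_) (^-^-comm B m k)) (sym (^-distrib-* A (B ℕ.^ k) m)) ⟩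
  (A ℕ.* B ℕ.^ k) ℕ.^ m
    ≤⟨ ℕ.^-monoˡ-≤ m h ⟩
  (2 ℕ.^ c ℕ.* (C ℕ.^ k ℕ.* D)) ℕ.^ m
    ≡⟨ trans (^-distrib-* (2 ℕ.^ c) (C ℕ.^ k ℕ.* D) m)
         (cong₂ ℕ._*_ (ℕ.^-*-assoc 2 c m) (trans (^-distrib-* (C ℕ.^ k) D m) (cong (ℕ._* D ℕ.^ m) (^-^-comm C k m)))) ⟩
  2 ℕ.^ (c ℕ.* m) ℕ.* ((C ℕ.^ m) ℕ.^ k ℕ.* D ℕ.^ m)
    ≤⟨ ℕ.*-monoʳ-≤ (2 ℕ.^ (c ℕ.* m)) (ℕ.*-mono-≤
         (ℕ.^-monoˡ-≤ k (ℕ.<⇒≤ (n<2^[1+⌊log₂n⌋] (C ℕ.^ m)))) (ℕ.<⇒≤ (n<2^[1+⌊log₂n⌋] (D ℕ.^ m)))) ⟩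
  2 ℕ.^ (c ℕ.* m) ℕ.* ((2 ℕ.^ suc γ) ℕ.^ k ℕ.* 2 ℕ.^ suc δ)
    ≡⟨ cong (2 ℕ.^ (c ℕ.* m) ℕ.*_) (trans (cong (ℕ._* 2 ℕ.^ suc δ) (ℕ.^-*-assoc 2 (suc γ) k))
         (sym (ℕ.^-distribˡ-+-* 2 (suc γ ℕ.* k) (suc δ)))) ⟩
  2 ℕ.^ (c ℕ.* m) ℕ.* 2 ℕ.^ (suc γ ℕ.* k ℕ.+ suc δ)
    ≡⟨ sym (ℕ.^-distribˡ-+-* 2 (c ℕ.* m) (suc γ ℕ.* k ℕ.+ suc δ)) ⟩
  2 ℕ.^ (c ℕ.* m ℕ.+ (suc γ ℕ.* k ℕ.+ suc δ)) ∎)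
  where
  open ℕ.≤-Reasoning
  α = ⌊log₂ A ℕ.^ m ⌋
  β = ⌊log₂ B ℕ.^ m ⌋
  γ = ⌊log₂ C ℕ.^ m ⌋
  δ = ⌊log₂ D ℕ.^ m ⌋

log-power-compareℚ : ∀ k c m A B C D → .{{ℕ.NonZero A}} → .{{ℕ.NonZero B}} →
  A ℕ.* B ℕ.^ k ≤ 2 ℕ.^ c ℕ.* (C ℕ.^ k ℕ.* D) →
  ι ⌊log₂ A ℕ.^ m ⌋ + ι ⌊log₂ B ℕ.^ m ⌋ * ι k ℚ.≤
  ι c * ι m + ((1ℚ + ι ⌊log₂ C ℕ.^ m ⌋) * ι k + (1ℚ + ι ⌊log₂ D ℕ.^ m ⌋))
log-power-compareℚ k c m A B C D h = subst₂ ℚ._≤_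
  (trans (ι-+ α (β ℕ.* k)) (cong (ι α +_) (ι-* β k)))
  (trans (ι-+ (c ℕ.* m) (suc γ ℕ.* k ℕ.+ suc δ)) (cong₂ _+_ (ι-* c m)
    (trans (ι-+ (suc γ ℕ.* k) (suc δ)) (cong₂ _+_ (trans (ι-* (suc γ) k) (cong (_* ι k) (ι-+ 1 γ))) (ι-+ 1 δ)))))
  (ι-mono-≤ (log-power-compare k c m A B C D h))
  where
  α = ⌊log₂ A ℕ.^ m ⌋
  β = ⌊log₂ B ℕ.^ m ⌋
  γ = ⌊log₂ C ℕ.^ m ⌋
  δ = ⌊log₂ D ℕ.^ m ⌋

ι-^ : ∀ m k → ι (m ℕ.^ k) ≡ ι m ^ k
ι-^ m zero    = refl
ι-^ m (suc k) = trans (ι-* m (m ℕ.^ k)) (cong (ι m *_) (ι-^ m k))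

0≤ι : ∀ n → 0ℚ ℚ.≤ ι n
0≤ι n = ι-mono-≤ {0} {n} ℕ.z≤n

ι∣↥∣ : ∀ {q} → 0ℚ ℚ.< q → ι ℤ.∣ ↥ q ∣ ≡ q * ι (↧ₙ q)
ι∣↥∣ {q} 0<q = trans (cong (ℚ._/ 1) (∣↥∣ 0<q)) (sym (q*↧q≡↥q q))

ι-numerator^ : ∀ {q} k → 0ℚ ℚ.< q → ι (ℤ.∣ ↥ q ∣ ℕ.^ k) ≡ q ^ k * ι (↧ₙ q ℕ.^ k)
ι-numerator^ {q} k 0<q = trans (ι-^ ℤ.∣ ↥ q ∣ k) (trans (cong (_^ k) (ι∣↥∣ 0<q))
  (trans (^ℚ-distrib-* q (ι (↧ₙ q)) k) (cong (q ^ k *_) (sym (ι-^ (↧ₙ q) k)))))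

log₂-approx-* : ∀ n q → log₂-approx n q * ι (suc n) ≡
  ι ⌊log₂ ℤ.∣ ↥ q ∣ ℕ.^ suc n ⌋ - ι ⌊log₂ ↧ₙ q ℕ.^ suc n ⌋
log₂-approx-* n q = trans (i/n*n≡i (⌊log₂ ℤ.∣ ↥ q ∣ ℕ.^ suc n ⌋ ℤ.⊖ ⌊log₂ ↧ₙ q ℕ.^ suc n ⌋) n)
  (⊖-/1 ⌊log₂ ℤ.∣ ↥ q ∣ ℕ.^ suc n ⌋ ⌊log₂ ↧ₙ q ℕ.^ suc n ⌋)

-- In the application `x` and `y` are the maximal biases of the k-fold sum and of `f` at index `n`.
-- The hypothesis `small` says that the rounding error k + 1, divided by the exponent `suc n`, is at
-- most `ε`.
module _ (k n : ℕ) {x y ε : ℚ} (0<x : 0ℚ ℚ.< x) (0<y : 0ℚ ℚ.< y) (small : ι (suc k) ℚ.≤ ε * ι (suc n)) where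

  private
    m : ℕ
    m = suc n
    μ κ X Y a b a′ b′ : ℚ
    μ  = ι m
    κ  = ι k
    X  = log₂-approx n x
    Y  = log₂-approx n y
    a  = ι ⌊log₂ ℤ.∣ ↥ x ∣ ℕ.^ m ⌋
    b  = ι ⌊log₂ ↧ₙ x ℕ.^ m ⌋
    a′ = ι ⌊log₂ ℤ.∣ ↥ y ∣ ℕ.^ m ⌋
    b′ = ι ⌊log₂ ↧ₙ y ℕ.^ m ⌋
    instance
      nzx : ℕ.NonZero ℤ.∣ ↥ x ∣
      nzx = ∣↥∣-nonZero 0<x
      nzy : ℕ.NonZero ℤ.∣ ↥ y ∣
      nzy = ∣↥∣-nonZero 0<y
    scaled : ∀ {p q} → p ℚ.≤ q → p * (ι (↧ₙ x) * ι (↧ₙ y ℕ.^ k)) ℚ.≤ q * (ι (↧ₙ x) * ι (↧ₙ y ℕ.^ k))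
    scaled = ℚ.*-monoʳ-≤-nonNeg _ {{nonNegative (≤-trans (0≤ι (↧ₙ x ℕ.* ↧ₙ y ℕ.^ k)) (≤-reflexive (ι-* (↧ₙ x) (↧ₙ y ℕ.^ k))))}}
    1+κ≤εμ : 1ℚ + κ ℚ.≤ ε * μ
    1+κ≤εμ = ≤-trans (≤-reflexive (sym (ι-+ 1 k))) small

  -- Both sides are multiplied by `μ`, which turns the approximate logarithms into differences of
  -- integer logarithms.
  -log₂-approx≤ : y ^ k ℚ.≤ x → - X ℚ.≤ κ * - Y + ε
  -log₂-approx≤ y^k≤x = ℚ.*-cancelʳ-≤-pos μ {{positive (ι-pos n)}} (begin
    - X * μ                                               ≡⟨ solve 2 (λ X μ → :- X :* μ := :- (X :* μ)) refl X μ ⟩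
    - (X * μ)                                             ≡⟨ cong -_ (log₂-approx-* n x) ⟩
    - (a - b)                                             ≡⟨ solve 4 (λ a b a′ κ → :- (a :- b) := (b :+ a′ :* κ) :- (a :+ a′ :* κ)) refl a b a′ κ ⟩
    -- The comparison is applied to 1/x ≤ (1/y)^k, hence the exchanged numerators and denominators
    -- and the exponent `c = 0`.
    (b + a′ * κ) - (a + a′ * κ)                           ≤⟨ ℚ.+-monoˡ-≤ (- (a + a′ * κ)) (log-power-compareℚ k 0 m (↧ₙ x) ℤ.∣ ↥ y ∣ (↧ₙ y) ℤ.∣ ↥ x ∣ natural) ⟩
    0ℚ * μ + ((1ℚ + b′) * κ + (1ℚ + a)) - (a + a′ * κ)    ≡⟨ solve 5 (λ μ a a′ b′ κ → con 0ℚ :* μ :+ ((con 1ℚ :+ b′) :* κ :+ (con 1ℚ :+ a)) :- (a :+ a′ :* κ)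
                                                               := κ :* (:- (a′ :- b′)) :+ (con 1ℚ :+ κ)) refl μ a a′ b′ κ ⟩
    κ * - (a′ - b′) + (1ℚ + κ)                            ≤⟨ ℚ.+-monoʳ-≤ (κ * - (a′ - b′)) 1+κ≤εμ ⟩
    κ * - (a′ - b′) + ε * μ                               ≡⟨ cong (λ z → κ * - z + ε * μ) (log₂-approx-* n y) ⟨
    κ * - (Y * μ) + ε * μ                                 ≡⟨ solve 4 (λ κ Y μ ε → κ :* :- (Y :* μ) :+ ε :* μ := (κ :* :- Y :+ ε) :* μ) refl κ Y μ ε ⟩
    (κ * - Y + ε) * μ                                     ∎)
    where
    open ℚ.≤-Reasoning
    natural : ↧ₙ x ℕ.* ℤ.∣ ↥ y ∣ ℕ.^ k ≤ 1 ℕ.* (↧ₙ y ℕ.^ k ℕ.* ℤ.∣ ↥ x ∣)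
    natural = ι-cancel-≤ (begin
      ι (↧ₙ x ℕ.* ℤ.∣ ↥ y ∣ ℕ.^ k)                  ≡⟨ trans (ι-* (↧ₙ x) (ℤ.∣ ↥ y ∣ ℕ.^ k)) (cong (ι (↧ₙ x) *_) (ι-numerator^ k 0<y)) ⟩
      ι (↧ₙ x) * (y ^ k * ι (↧ₙ y ℕ.^ k))           ≡⟨ solve 3 (λ d p e → d :* (p :* e) := p :* (d :* e)) refl (ι (↧ₙ x)) (y ^ k) (ι (↧ₙ y ℕ.^ k)) ⟩
      y ^ k * (ι (↧ₙ x) * ι (↧ₙ y ℕ.^ k))           ≤⟨ scaled y^k≤x ⟩
      x * (ι (↧ₙ x) * ι (↧ₙ y ℕ.^ k))               ≡⟨ solve 3 (λ x d e → x :* (d :* e) := e :* (x :* d)) refl x (ι (↧ₙ x)) (ι (↧ₙ y ℕ.^ k)) ⟩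
      ι (↧ₙ y ℕ.^ k) * (x * ι (↧ₙ x))               ≡⟨ cong (ι (↧ₙ y ℕ.^ k) *_) (ι∣↥∣ 0<x) ⟨
      ι (↧ₙ y ℕ.^ k) * ι ℤ.∣ ↥ x ∣                  ≡⟨ ι-* (↧ₙ y ℕ.^ k) ℤ.∣ ↥ x ∣ ⟨
      ι (↧ₙ y ℕ.^ k ℕ.* ℤ.∣ ↥ x ∣)                  ≡⟨ cong ι (ℕ.*-identityˡ (↧ₙ y ℕ.^ k ℕ.* ℤ.∣ ↥ x ∣)) ⟨
      ι (1 ℕ.* (↧ₙ y ℕ.^ k ℕ.* ℤ.∣ ↥ x ∣))          ∎)

  -- The term `- Y + - 1ℚ` is what `disc f μ -ᴿ 1ᴿ` unfolds to at an index.
  ≤-log₂-approx : x ℚ.≤ (ι 2 * y) ^ k → κ * (- Y + - 1ℚ) ℚ.≤ - X + ε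
  ≤-log₂-approx x≤[2y]^k = ℚ.*-cancelʳ-≤-pos μ {{positive (ι-pos n)}} (begin
    κ * (- Y + - 1ℚ) * μ                                       ≡⟨ solve 3 (λ κ Y μ → κ :* (:- Y :+ :- con 1ℚ) :* μ := κ :* (:- (Y :* μ) :- μ)) refl κ Y μ ⟩
    κ * (- (Y * μ) - μ)                                        ≡⟨ cong (λ z → κ * (- z - μ)) (log₂-approx-* n y) ⟩
    κ * (- (a′ - b′) - μ)                                      ≡⟨ solve 5 (λ a a′ b′ κ μ → κ :* (:- (a′ :- b′) :- μ) := (a :+ b′ :* κ) :- (a :+ a′ :* κ :+ κ :* μ)) refl a a′ b′ κ μ ⟩
    -- The comparison is applied to x ≤ 2^k y^k, so `c = k`. The resulting `κ * μ` cancels the loss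
    -- of 1 per block.
    (a + b′ * κ) - (a + a′ * κ + κ * μ)                        ≤⟨ ℚ.+-monoˡ-≤ (- (a + a′ * κ + κ * μ)) (log-power-compareℚ k k m ℤ.∣ ↥ x ∣ (↧ₙ y) ℤ.∣ ↥ y ∣ (↧ₙ x) natural) ⟩
    κ * μ + ((1ℚ + a′) * κ + (1ℚ + b)) - (a + a′ * κ + κ * μ)  ≡⟨ solve 5 (λ a b a′ κ μ → κ :* μ :+ ((con 1ℚ :+ a′) :* κ :+ (con 1ℚ :+ b)) :- (a :+ a′ :* κ :+ κ :* μ)
                                                                    := :- (a :- b) :+ (con 1ℚ :+ κ)) refl a b a′ κ μ ⟩
    - (a - b) + (1ℚ + κ)                                       ≤⟨ ℚ.+-monoʳ-≤ (- (a - b)) 1+κ≤εμ ⟩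
    - (a - b) + ε * μ                                          ≡⟨ cong (λ z → - z + ε * μ) (log₂-approx-* n x) ⟨
    - (X * μ) + ε * μ                                          ≡⟨ solve 3 (λ X μ ε → :- (X :* μ) :+ ε :* μ := (:- X :+ ε) :* μ) refl X μ ε ⟩
    (- X + ε) * μ                                              ∎)
    where
    open ℚ.≤-Reasoning
    natural : ℤ.∣ ↥ x ∣ ℕ.* ↧ₙ y ℕ.^ k ≤ 2 ℕ.^ k ℕ.* (ℤ.∣ ↥ y ∣ ℕ.^ k ℕ.* ↧ₙ x)
    natural = ι-cancel-≤ (begin
      ι (ℤ.∣ ↥ x ∣ ℕ.* ↧ₙ y ℕ.^ k)                            ≡⟨ trans (ι-* ℤ.∣ ↥ x ∣ (↧ₙ y ℕ.^ k)) (cong (_* ι (↧ₙ y ℕ.^ k)) (ι∣↥∣ 0<x)) ⟩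
      x * ι (↧ₙ x) * ι (↧ₙ y ℕ.^ k)                           ≡⟨ ℚ.*-assoc x (ι (↧ₙ x)) (ι (↧ₙ y ℕ.^ k)) ⟩
      x * (ι (↧ₙ x) * ι (↧ₙ y ℕ.^ k))                         ≤⟨ scaled x≤[2y]^k ⟩
      (ι 2 * y) ^ k * (ι (↧ₙ x) * ι (↧ₙ y ℕ.^ k))             ≡⟨ cong (_* (ι (↧ₙ x) * ι (↧ₙ y ℕ.^ k))) (^ℚ-distrib-* (ι 2) y k) ⟩
      ι 2 ^ k * y ^ k * (ι (↧ₙ x) * ι (↧ₙ y ℕ.^ k))           ≡⟨ solve 4 (λ t p d e → t :* p :* (d :* e) := t :* (p :* e :* d)) refl (ι 2 ^ k) (y ^ k) (ι (↧ₙ x)) (ι (↧ₙ y ℕ.^ k)) ⟩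
      ι 2 ^ k * (y ^ k * ι (↧ₙ y ℕ.^ k) * ι (↧ₙ x))           ≡⟨ cong₂ (λ s t → s * (t * ι (↧ₙ x))) (ι-^ 2 k) (ι-numerator^ k 0<y) ⟨
      ι (2 ℕ.^ k) * (ι (ℤ.∣ ↥ y ∣ ℕ.^ k) * ι (↧ₙ x))          ≡⟨ cong (ι (2 ℕ.^ k) *_) (ι-* (ℤ.∣ ↥ y ∣ ℕ.^ k) (↧ₙ x)) ⟨
      ι (2 ℕ.^ k) * ι (ℤ.∣ ↥ y ∣ ℕ.^ k ℕ.* ↧ₙ x)              ≡⟨ ι-* (2 ℕ.^ k) (ℤ.∣ ↥ y ∣ ℕ.^ k ℕ.* ↧ₙ x) ⟨
      ι (2 ℕ.^ k ℕ.* (ℤ.∣ ↥ y ∣ ℕ.^ k ℕ.* ↧ₙ x))              ∎)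

-- Passage to the limit

eventually-small : ∀ k ε → 0ℚ ℚ.< ε → Eventually λ n → ι k ℚ.≤ ε * ι (suc n)
eventually-small k ε 0<ε = k ℕ.* ↧ₙ ε , λ n h → begin
  -- The threshold suffices because the numerator of `ε` is at least 1, so that `ε` is at least 1 /
  -- `↧ₙ ε`.
  ι k                                ≤⟨ ι-mono-≤ (ℕ.m≤n*m k ℤ.∣ ↥ ε ∣ {{∣↥∣-nonZero 0<ε}}) ⟩
  ι (ℤ.∣ ↥ ε ∣ ℕ.* k)                ≡⟨ trans (ι-* ℤ.∣ ↥ ε ∣ k) (cong (_* ι k) (ι∣↥∣ 0<ε)) ⟩
  ε * ι (↧ₙ ε) * ι k                 ≡⟨ solve 3 (λ e d k → e :* d :* k := e :* (k :* d)) refl ε (ι (↧ₙ ε)) (ι k) ⟩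
  ε * (ι k * ι (↧ₙ ε))               ≡⟨ cong (ε *_) (ι-* k (↧ₙ ε)) ⟨
  ε * ι (k ℕ.* ↧ₙ ε)                 ≤⟨ ℚ.*-monoˡ-≤-nonNeg ε {{nonNegative (ℚ.<⇒≤ 0<ε)}} (ι-mono-≤ (ℕ.m≤n⇒m≤1+n h)) ⟩
  ε * ι (suc n)                      ∎
  where open ℚ.≤-Reasoning

eventually-pos : ∀ x → 0ᴿ <ᴿ x → Eventually λ n → 0ℚ ℚ.< seq x n
eventually-pos x (δ , 0<δ , N , h) = N , λ n n≥N →
  ℚ.<-≤-trans 0<δ (≤-trans (≤-reflexive (sym (ℚ.+-identityˡ δ))) (h n n≥N))

eventually-all : ∀ {P Q R X : ℕ → Set} → (∀ n → P n → Q n → R n → X n) →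
  Eventually P → Eventually Q → Eventually R → Eventually X
eventually-all f p q (K , r) =
  let N , pq = eventually-× _,_ p q
  in N ℕ.⊔ K , λ n h → let Pn , Qn = pq n (ℕ.m⊔n≤o⇒m≤o N K h) in f n Pn Qn (r n (ℕ.m⊔n≤o⇒n≤o N K h))

lemma7 : (n : ℕ) (f : Cube n → Bool) (μ : Distribution n) (k : ℕ) → 1 ≤ k →
    (disc (f ^⊕ k) (μ ^ᴰ k) ≤ᴿ fromℕ k *ᴿ disc f μ)
    × (fromℕ k *ᴿ (disc f μ -ᴿ 1ᴿ) ≤ᴿ disc (f ^⊕ k) (μ ^ᴰ k))
lemma7 n f μ k _ =
  -- The order on the reals asks for the inequality up to `ε` from some index on. That index must
  -- make both maximal biases positive, so that their approximate logarithms are meaningful, and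
  -- make the rounding error at most `ε`.
  (λ ε 0<ε → eventually-all (λ i 0<x 0<y small → -log₂-approx≤ k i 0<x 0<y small (maxBias^k≤ f μ i k))
    Mₖ-pos M-pos (eventually-small (suc k) ε 0<ε)) ,
  (λ ε 0<ε → eventually-all (λ i 0<x 0<y small → ≤-log₂-approx k i 0<x 0<y small (maxBias≤[2*]^k f μ i k))
    Mₖ-pos M-pos (eventually-small (suc k) ε 0<ε))
  where
  M-pos : Eventually λ i → 0ℚ ℚ.< seq (maxBias f μ) i
  M-pos = eventually-pos (maxBias f μ) (maxBias-pos f μ)
  Mₖ-pos : Eventually λ i → 0ℚ ℚ.< seq (maxBias (f ^⊕ k) (μ ^ᴰ k)) i
  Mₖ-pos = eventually-pos (maxBias (f ^⊕ k) (μ ^ᴰ k)) (maxBias-pos (f ^⊕ k) (μ ^ᴰ k))
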